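{- Let $\mathcal{A}$ be a collection of hyperplanes in $Q = S_1\times\cdots\times S_n$, no two of which are parallel, let $0\le a\le n$, let $\mathbb{P}_a$ be a probability measure on $Q_a$, let $\delta_{a+1},\dots,\delta_n \in [0,1/2]$, and let $\mathbb{P}_k$, $\alpha_k$, $c_k$ be defined as in the context. Then for each $a < k \le n$, $$M_k^{(1)} \le \frac{c_{k-1}(1)}{|S_k|} \qquad\text{and}\qquad M_k^{(2)} \le \frac{c_{k-1}(3)}{|S_k|^2}.$$ Moreover, if in addition $|S_j| \ge 3$ for each $j\in[n]$, and no hyperplane $A_F$ with $F \in \mathcal{N}_k$ has $|F| = 1$, then $$M_k^{(2)} \le \frac{1}{|S_k|^2}\big(c_{k-1}(3) - 2c_{k-1}(1) + 1\big).$$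
   Context: $S_1,\dots,S_n$ are finite sets each with at least two elements; $Q = S_1\times\cdots\times S_n$ and $Q_k = S_1\times\cdots\times S_k$. A hyperplane is $A = A_1\times\cdots\times A_n\subseteq Q$ with each $A_k$ either $S_k$ or a singleton in $S_k$; $F(A)=\{k: A_k\text{ is a singleton}\}$ is its set of fixed coordinates; hyperplanes are parallel if they have the same $F$. Hyperplanes in $\mathcal{A}$ have non-empty $F(A)$; since no two are parallel, write $\mathcal{A}=\{A_F : F\in\mathcal{F}\}$ with $\mathcal{F}=\{F(A):A\in\mathcal{A}\}$. A set $X\subseteq Q_k$ is identified with $X\times S_{k+1}\times\cdots\times S_n\subseteq Q$ (such sets are called $Q_k$-measurable); a hyperplane with $F(A)\subseteq[k]$ is viewed as a subset of $Q_k$. Let $\mathcal{F}_k=\{F\in\mathcal{F}: F\subseteq[k]\}$, $\mathcal{N}_k = \mathcal{F}_k\setminus\mathcal{F}_{k-1}$ and $B_k = \bigcup_{F\in\mathcal{N}_k} A_F\subseteq Q_k$. Measures: given $\mathbb{P}_{k-1}$ on $Q_{k-1}$ ($k>a$), for $x\in Q_{k-1}$ let $\alpha_k(x) = |\{y\in S_k : (x,y)\in B_k\}|/|S_k|$, and for $x\in Q_{k-1}, y\in S_k$ set $\mathbb{P}_k(x,y) = \max\{0, \frac{\alpha_k(x)-\delta_k}{\alpha_k(x)(1-\delta_k)}\}\cdot \frac{\mathbb{P}_{k-1}(x)}{|S_k|}$ if $(x,y)\in B_k$, and $\mathbb{P}_k(x,y)=\min\{\frac{1}{1-\alpha_k(x)},\frac{1}{1-\delta_k}\}\cdot\frac{\mathbb{P}_{k-1}(x)}{|S_k|}$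 otherwise. Let $\mathbb{E}_{k-1}$ denote expectation over $x\sim\mathbb{P}_{k-1}$, and $M_k^{(1)}=\mathbb{E}_{k-1}[\alpha_k(x)]$, $M_k^{(2)}=\mathbb{E}_{k-1}[\alpha_k(x)^2]$. For $I\subseteq[a]$, $c(I)=\max\{\mathbb{P}_a(H): H \text{ a hyperplane in } Q_a \text{ with } F(H)=I\}$ (so $c(\emptyset)=1$); for $J\subseteq[a+1,n]$, $\nu(J)=\prod_{j\in J}\frac{1}{(1-\delta_j)|S_j|}$; and for $k\ge a$, $c_k(x) = \sum_{I\subseteq[a]}c(I)x^{|I|}\prod_{j=a+1}^k\big(1+\frac{x}{(1-\delta_j)|S_j|}\big)$. -}

module Defs where

open import Level using (Level; suc; _⊔_)
open import Algebra.Bundles using (CommutativeRing; Semiring)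
import Algebra.Construct.NaturalChoice.Max as NaturalMax
import Algebra.Construct.NaturalChoice.Min as NaturalMin
import Algebra.Definitions.RawSemiring as RawSemiringDefinitions
open import Data.Bool.Base using (if_then_else_)
import Data.Bool.Properties as Bool
open import Data.Fin.Base using (Fin)
import Data.Fin.Properties as Fin
open import Data.Fin.Subset using (Subset; inside; outside; ∣_∣)
open import Data.List.Base
  using (List; []; _∷_; _++_; map; mapMaybe; filter; filterᵇ; foldr; length; allFin; cartesianProductWith)
open import Data.List.Relation.Unary.Any using (Any; any?)
open import Data.Maybe.Base using (Maybe; just; nothing; is-just; is-nothing)
open import Data.Nat.Base using (ℕ; zero)
import Data.Nat.Base as ℕ
import Data.Nat.Properties as ℕ
open import Data.Product.Base using (_×_; _,_)
open import Data.Unit.Base using (⊤; tt)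
import Data.Vec.Base as Vec
import Data.Vec.Properties as Vec
open import Function.Base using (_∘_)
open import Relation.Binary.Bundles using (TotalOrder)
open import Relation.Binary.Core using (Rel)
open import Relation.Binary.PropositionalEquality using (_≡_; refl)
open import Relation.Binary.Structures using (IsTotalOrder)
open import Relation.Nullary using (¬_; Dec; yes; no; does; _×-dec_)
open import Relation.Unary using (Pred; Decidable)

-- Stands in for the real numbers, which the library lacks.
record OrderedField c ℓ₁ ℓ₂ : Set (suc (c ⊔ ℓ₁ ⊔ ℓ₂)) where
  infix  4 _≤_
  infix  8 _⁻¹
  infixl 7 _/_
  field
    commutativeRing : CommutativeRing c ℓ₁

  open CommutativeRing commutativeRing public

  field
    _≤_          : Rel Carrier ℓ₂
    isTotalOrder : IsTotalOrder _≈_ _≤_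
    +-monoʳ-≤    : ∀ x {y z} → y ≤ z → x + y ≤ x + z
    *-nonNeg     : ∀ {x y} → 0# ≤ x → 0# ≤ y → 0# ≤ x * y
    1≉0          : ¬ (1# ≈ 0#)
    -- Total for convenience: the value of 0# ⁻¹ is unspecified.
    _⁻¹          : Carrier → Carrier
    ⁻¹-cong      : ∀ {x y} → x ≈ y → x ⁻¹ ≈ y ⁻¹
    *-inverseʳ   : ∀ {x} → ¬ (x ≈ 0#) → x * x ⁻¹ ≈ 1#

  totalOrder : TotalOrder c ℓ₁ ℓ₂
  totalOrder = record { isTotalOrder = isTotalOrder }

  open NaturalMax totalOrder public using () renaming (_⊔_ to max)
  open NaturalMin totalOrder public using () renaming (_⊓_ to min)
  open RawSemiringDefinitions (Semiring.rawSemiring semiring) public using (_^_) renaming (_×_ to _·_)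

  _/_ : Carrier → Carrier → Carrier
  x / y = x * y ⁻¹

  fromℕ : ℕ → Carrier
  fromℕ m = m · 1#

  ∑ : ∀ {b} {B : Set b} → List B → (B → Carrier) → Carrier
  ∑ xs f = foldr _+_ 0# (map f xs)

  infix 5 ∑
  syntax ∑ xs (λ x → e) = ∑[ x ∈ xs ] e

-- (t₁ , … , tₖ) with tⱼ : T j; coordinates are numbered from 1, and T 0 is unused.
infixl 5 _▸_
data Tuple (T : ℕ → Set) : ℕ → Set where
  []  : Tuple T 0
  _▸_ : ∀ {k} → Tuple T k → T (ℕ.suc k) → Tuple T (ℕ.suc k)

tuples : ∀ {T} → (∀ j → List (T j)) → ∀ k → List (Tuple T k)
tuples ts zero      = [] ∷ []
tuples ts (ℕ.suc k) = cartesianProductWith _▸_ (tuples ts k) (ts (ℕ.suc k))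

-- S_j is Fin (s j), so Q s k is Q_k = S_1 × ⋯ × S_k.
Q : (ℕ → ℕ) → ℕ → Set
Q s = Tuple (λ j → Fin (s j))

-- A hyperplane A_1 × ⋯ × A_k in Q_k: `nothing` means A_j = S_j, and
-- `just y` means A_j = {y}.
Hyperplane : (ℕ → ℕ) → ℕ → Set
Hyperplane s = Tuple (λ j → Maybe (Fin (s j)))

points : ∀ s k → List (Q s k)
points s = tuples (λ j → allFin (s j))

hyperplanes : ∀ s k → List (Hyperplane s k)
hyperplanes s = tuples (λ j → nothing ∷ map just (allFin (s j)))

subsets : ∀ k → List (Subset k)
subsets zero      = Vec.[] ∷ []
subsets (ℕ.suc k) = map (outside Vec.∷_) (subsets k) ++ map (inside Vec.∷_) (subsets k)

module _ {s : ℕ → ℕ} where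

  -- Subsets of [k] are listed from coordinate k down to coordinate 1, so
  -- that the head of a Subset (suc k) tells whether suc k belongs to it.
  F : ∀ {k} → Hyperplane s k → Subset k
  F []      = Vec.[]
  F (A ▸ m) = is-just m Vec.∷ F A

  Parallel : ∀ {k} → Hyperplane s k → Hyperplane s k → Set
  Parallel A A′ = F A ≡ F A′

  _∈ᶜ_ : ∀ {j} → Fin (s j) → Maybe (Fin (s j)) → Set
  y ∈ᶜ nothing = ⊤
  y ∈ᶜ just z  = y ≡ z

  _∈ᴴ_ : ∀ {k} → Q s k → Hyperplane s k → Set
  []      ∈ᴴ []      = ⊤
  (x ▸ y) ∈ᴴ (A ▸ m) = (x ∈ᴴ A) × (y ∈ᶜ m)

  _∈ᶜ?_ : ∀ {j} (y : Fin (s j)) m → Dec (y ∈ᶜ m)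
  y ∈ᶜ? nothing = yes tt
  y ∈ᶜ? just z  = y Fin.≟ z

  _∈ᴴ?_ : ∀ {k} (x : Q s k) (A : Hyperplane s k) → Dec (x ∈ᴴ A)
  []      ∈ᴴ? []      = yes tt
  (x ▸ y) ∈ᴴ? (A ▸ m) = (x ∈ᴴ? A) ×-dec (y ∈ᶜ? m)

  -- For k ≤ n: just the hyperplane A viewed as a subset of Q_k when
  -- F(A) ⊆ [k], and nothing when F(A) ⊈ [k].
  inQ : ∀ k {n} → Hyperplane s n → Maybe (Hyperplane s k)
  inQ k {n} A with n ℕ.≟ k
  inQ k A            | yes refl = just A
  inQ k []           | no _     = nothing
  inQ k (A ▸ nothing) | no _    = inQ k A
  inQ k (A ▸ just _)  | no _    = nothing

  -- In 𝒩, B, α and factor, the argument k stands for the index k + 1.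

  -- {A_F : F ∈ 𝓕ₖ₊₁ ∖ 𝓕ₖ}, viewed in Q_{k+1}.
  𝒩 : ∀ {n} → List (Hyperplane s n) → ∀ k → List (Hyperplane s (ℕ.suc k))
  𝒩 𝒜 k = mapMaybe (inQ (ℕ.suc k)) (filterᵇ (is-nothing ∘ inQ k) 𝒜)

  B : ∀ {n} → List (Hyperplane s n) → ∀ k → Pred (Q s (ℕ.suc k)) _
  B 𝒜 k x = Any (x ∈ᴴ_) (𝒩 𝒜 k)

  B? : ∀ {n} (𝒜 : List (Hyperplane s n)) k → Decidable (B 𝒜 k)
  B? 𝒜 k x = any? (x ∈ᴴ?_) (𝒩 𝒜 k)

module _ {c ℓ₁ ℓ₂} (K : OrderedField c ℓ₁ ℓ₂) where
  open OrderedField K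

  record IsProbability {s k} (P : Q s k → Carrier) : Set (ℓ₁ ⊔ ℓ₂ ⊔ c) where
    field
      nonNeg : ∀ x → 0# ≤ P x
      total  : ∑[ x ∈ points s k ] P x ≈ 1#

  measure : ∀ {s k} → (Q s k → Carrier) → Hyperplane s k → Carrier
  measure {s} {k} P H = ∑[ x ∈ filter (_∈ᴴ? H) (points s k) ] P x

  module Construction
    (s : ℕ → ℕ) {n : ℕ} (𝒜 : List (Hyperplane s n))
    {a : ℕ} (Pₐ : Q s a → Carrier) (δ : ℕ → Carrier)
    where

    ∣S_∣ : ℕ → Carrier
    ∣S j ∣ = fromℕ (s j)

    α : ∀ k → Q s k → Carrier
    α k x = fromℕ (length (filter (λ y → B? 𝒜 k (x ▸ y)) (allFin (s (ℕ.suc k)))))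
              / ∣S ℕ.suc k ∣

    -- Where δ (k + 1) ≠ 1, both branches divide only by nonzero elements:
    -- α > 0 on B, and α < 1 at any x with a point (x , y) off B.
    factor : ∀ k → Q s k → Fin (s (ℕ.suc k)) → Carrier
    factor k x y =
      if does (B? 𝒜 k (x ▸ y))
      then max 0# ((α k x - δ (ℕ.suc k)) / (α k x * (1# - δ (ℕ.suc k))))
      else min (1# / (1# - α k x)) (1# / (1# - δ (ℕ.suc k)))

    -- ℙ d is the measure on Q_{a+d}.
    ℙ : ∀ d → Q s (d ℕ.+ a) → Carrier
    ℙ zero      x       = Pₐ x
    ℙ (ℕ.suc d) (x ▸ y) =
      factor (d ℕ.+ a) x y * (ℙ d x / ∣S ℕ.suc (d ℕ.+ a) ∣)

    -- M r d is M_k^{(r)} for k = a + d + 1.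
    M : ℕ → ℕ → Carrier
    M r d = ∑[ x ∈ points s (d ℕ.+ a) ] (ℙ d x * α (d ℕ.+ a) x ^ r)

    -- Starting the maximum at 0# is harmless: it is over a nonempty family
    -- (when every S_j is nonempty) of nonnegative numbers.
    cᴵ : Subset a → Carrier
    cᴵ I = foldr max 0#
      (map (measure Pₐ) (filter (λ H → Vec.≡-dec Bool._≟_ (F H) I) (hyperplanes s a)))

    ∏ : ℕ → Carrier → Carrier
    ∏ zero      x = 1#
    ∏ (ℕ.suc d) x = ∏ d x * (1# + x / ((1# - δ j) * ∣S j ∣))
      where j = ℕ.suc (d ℕ.+ a)

    -- cₓ d is the polynomial c_{a+d}.
    cₓ : ℕ → Carrier → Carrier
    cₓ d x = ∑[ I ∈ subsets a ] (cᴵ I * x ^ ∣ I ∣ * ∏ d x)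

{-# OPTIONS --safe #-}
module Submission where

-- α_k(x) is at most 1/|S_k| times the number of A ∈ 𝒩_k whose trace on Q_{k-1}
-- contains x, so M_k^{(1)} and M_k^{(2)} are bounded by sums of ℙ_{k-1}(A) and of
-- ℙ_{k-1}(A ∩ A′) over traces, whose fixed sets are pairwise distinct. Passing
-- from ℙ_{k-1} to ℙ_k does not increase the measure of a Q_{k-1}-measurable set,
-- and ℙ_k(x,y) ≤ ℙ_{k-1}(x) / ((1-δ_k)|S_k|), hence ℙ_{k-1}(H) ≤ c(I) ν(J) when
-- F(H) = I ∪ J. Summing over all fixed sets gives c_{k-1}(1); summing over pairs
-- gives c_{k-1}(3), since a set G is the union of 3^|G| ordered pairs. If no trace
-- is all of Q_{k-1}, the pairs with an empty member can be left out.

open import Defs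
import Algebra.Construct.NaturalChoice.Max as Max
import Algebra.Construct.NaturalChoice.Min as Min
import Algebra.Properties.Group as GroupProperties
import Algebra.Properties.Ring as RingProperties
import Algebra.Solver.Ring.NaturalCoefficients.Default as SemiringSolver
open import Data.Bool.Base using (if_then_else_)
import Data.Bool.Properties as Bool
open import Data.Fin.Base using (Fin)
import Data.Fin.Properties as Fin
open import Data.Fin.Subset using (Subset; Nonempty; inside; outside; ∣_∣; ⊥; _∪_)
open import Data.Fin.Subset.Properties using (∣⊥∣≡0; ∪-identityˡ; ∪-identityʳ)
open import Data.List.Base
  using (List; []; _∷_; _++_; map; filter; foldr; length; allFin; cartesianProductWith)
open import Data.List.Membership.Propositional using (_∈_)
open import Data.List.Membership.Propositional.Properties
  using (∈-∃++; ∈-++⁺ˡ; ∈-++⁺ʳ; ∈-++⁻; ∈-map⁺; ∈-filter⁺; ∈-filter⁻; ∈-allFin; ∈-cartesianProductWith⁺)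
open import Data.List.Properties using (filter-some; length-tabulate)
open import Data.List.Relation.Binary.Subset.Propositional using (_⊆_)
open import Data.List.Relation.Unary.All as All using (All; []; _∷_)
open import Data.List.Relation.Unary.AllPairs using (AllPairs; []; _∷_)
import Data.List.Relation.Unary.All.Properties as All
open import Data.List.Relation.Unary.Any as Any using (Any; here; there)
open import Data.List.Relation.Unary.Unique.Propositional using (Unique)
import Data.List.Relation.Unary.Unique.Propositional.Properties as Unique
open import Data.Maybe.Base using (Maybe; just; nothing; is-just; _<∣>_)
open import Data.Nat.Base as ℕ using (ℕ; zero; suc)
import Data.Nat.Properties as ℕ
open import Data.Product.Base using (_×_; _,_; proj₁; proj₂)
open import Data.Sum.Base using (_⊎_; inj₁; inj₂)
open import Data.Unit.Base using (tt)
import Data.Vec.Base as Vec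
import Data.Vec.Properties as Vec
open import Function.Base using (_∘_; id)
import Relation.Binary.Reasoning.PartialOrder as PartialOrderReasoning
open import Relation.Binary.PropositionalEquality as ≡ using (_≡_; _≢_)
open import Relation.Binary.Bundles using (TotalOrder)
open import Relation.Nullary using (¬_; ¬?; Dec; yes; no; does; _×-dec_; contradiction)
open import Relation.Unary using (Pred; Decidable)

-- Working with fixed sets removes the geometry. One weight per coordinate set bounds the measure of
-- every hyperplane with that fixed set, whatever its values, so only the sets that occur matter,
-- and non-parallelism says that each occurs at most once. The weight is multiplicative over the
-- coordinates beyond `a`; this is why sums over subsets collapse to the product in c_k, with x the
-- number of ways in which a chosen coordinate can occur: once for a single set, three ways for a
-- pair. Two hyperplanes may be disjoint, so their intersection need not be a hyperplane. It is
-- replaced by a larger one with the right fixed set, which is enough because all estimates go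
-- upward. For the same reason the mass of a fibre is only bounded from above, so each maximum or
-- minimum in the reweighting can be replaced by the entry that suits the case. The delicate point
-- there is division: the inverse of 0 is unspecified, and positivity of α, or of 1 - α, has to come
-- from a point of the fibre lying in B, or off B, or from a comparison with δ.

module OrderedFieldProperties {c ℓ₁ ℓ₂} (K : OrderedField c ℓ₁ ℓ₂) where
  open OrderedField K
  open TotalOrder totalOrder public
    using (poset; antisym)
    renaming (total to ≤-total; refl to ≤-refl; reflexive to ≤-reflexive; trans to ≤-trans)
  open Max totalOrder public using (x≤x⊔y; x≤y⊔x; ⊔-lub)
  open Min totalOrder public using (x⊓y≤x; x⊓y≤y; ⊓-glb)
  open PartialOrderReasoning poset
  open SemiringSolver commutativeSemiring public
    using (solve; con; _:+_; _:*_; _:=_)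
  open RingProperties ring using (-1*x≈-x; -‿involutive)
  open GroupProperties +-group using () renaming (\\-leftDividesˡ to x+[-x+y]≈y; ∙-cancelˡ to +-cancelˡ)

  -- Order, positivity and inverses in an ordered field.

  +-mono-≤ : ∀ {x y z w} → x ≤ y → z ≤ w → x + z ≤ y + w
  +-mono-≤ {x} {y} {z} {w} x≤y z≤w = begin
    x + z ≤⟨ +-monoʳ-≤ x z≤w ⟩
    x + w ≈⟨ +-comm x w ⟩
    w + x ≤⟨ +-monoʳ-≤ w x≤y ⟩
    w + y ≈⟨ +-comm w y ⟩
    y + w ∎

  +-cancelˡ-≤ : ∀ x {y z} → x + y ≤ x + z → y ≤ z
  +-cancelˡ-≤ x {y} {z} le = begin
    y               ≈⟨ cancel y ⟨
    - x + (x + y)   ≤⟨ +-monoʳ-≤ (- x) le ⟩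
    - x + (x + z)   ≈⟨ cancel z ⟩
    z               ∎
    where
    cancel : ∀ w → - x + (x + w) ≈ w
    cancel w = trans (sym (+-assoc _ _ _)) (trans (+-congʳ (-‿inverseˡ x)) (+-identityˡ w))

  x+[y-x]≈y : ∀ x y → x + (y - x) ≈ y
  x+[y-x]≈y x y = trans (+-congˡ (+-comm y (- x))) (x+[-x+y]≈y x y)

  0≤y-x : ∀ {x y} → x ≤ y → 0# ≤ y - x
  0≤y-x {x} {y} x≤y = +-cancelˡ-≤ x (begin
    x + 0#      ≈⟨ +-identityʳ x ⟩
    x           ≤⟨ x≤y ⟩
    y           ≈⟨ x+[y-x]≈y x y ⟨
    x + (y - x) ∎)

  -- Subtraction-free form of the inequality, to which the semiring solver applies.
  ≤-minus : ∀ {x y z} → y + x ≤ z → x ≤ z - y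
  ≤-minus {x} {y} {z} le = +-cancelˡ-≤ y (≤-trans le (≤-reflexive (sym (x+[y-x]≈y y z))))

  -‿anti-mono : ∀ x {y z} → y ≤ z → x - z ≤ x - y
  -‿anti-mono x {y} {z} y≤z = ≤-minus (begin
    y + (x - z) ≤⟨ +-mono-≤ y≤z ≤-refl ⟩
    z + (x - z) ≈⟨ x+[y-x]≈y z x ⟩
    x           ∎)

  *-monoˡ-≤ : ∀ {z x y} → 0# ≤ z → x ≤ y → z * x ≤ z * y
  *-monoˡ-≤ {z} {x} {y} 0≤z x≤y = begin
    z * x                 ≈⟨ +-identityʳ _ ⟨
    z * x + 0#            ≤⟨ +-monoʳ-≤ _ (*-nonNeg 0≤z (0≤y-x x≤y)) ⟩
    z * x + z * (y - x)   ≈⟨ distribˡ _ _ _ ⟨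
    z * (x + (y - x))     ≈⟨ *-congˡ (x+[y-x]≈y x y) ⟩
    z * y                 ∎

  *-monoʳ-≤ : ∀ {z x y} → 0# ≤ z → x ≤ y → x * z ≤ y * z
  *-monoʳ-≤ {z} {x} {y} 0≤z x≤y = begin
    x * z ≈⟨ *-comm x z ⟩
    z * x ≤⟨ *-monoˡ-≤ 0≤z x≤y ⟩
    z * y ≈⟨ *-comm z y ⟩
    y * z ∎

  *-mono-≤ : ∀ {x y z w} → 0# ≤ y → 0# ≤ z → x ≤ y → z ≤ w → x * z ≤ y * w
  *-mono-≤ 0≤y 0≤z x≤y z≤w = ≤-trans (*-monoʳ-≤ 0≤z x≤y) (*-monoˡ-≤ 0≤y z≤w)

  +-nonNeg : ∀ {x y} → 0# ≤ x → 0# ≤ y → 0# ≤ x + y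
  +-nonNeg 0≤x 0≤y = ≤-trans (≤-reflexive (sym (+-identityʳ 0#))) (+-mono-≤ 0≤x 0≤y)

  0≤1 : 0# ≤ 1#
  0≤1 with ≤-total 0# 1#
  ... | inj₁ 0≤1 = 0≤1
  -- Here `0# - 1#` is nonnegative, and its square is 1.
  ... | inj₂ 1≤0 = begin
    0#                  ≤⟨ *-nonNeg 0≤-1 0≤-1 ⟩
    (0# - 1#) * (0# - 1#) ≈⟨ *-cong (+-identityˡ _) (+-identityˡ _) ⟩
    - 1# * - 1#         ≈⟨ -1*x≈-x (- 1#) ⟩
    - - 1#              ≈⟨ -‿involutive 1# ⟩
    1#                  ∎
    where
    0≤-1 : 0# ≤ 0# - 1#
    0≤-1 = 0≤y-x 1≤0

  -- `OrderedField` has no strict order; a positive element is a nonnegative one to which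
  -- `*-inverseʳ` applies.
  Positive : Carrier → Set _
  Positive x = 0# ≤ x × ¬ (x ≈ 0#)

  positive-≤ : ∀ {x y} → Positive x → x ≤ y → Positive y
  positive-≤ (0≤x , x≉0) x≤y =
    ≤-trans 0≤x x≤y , λ y≈0 → x≉0 (antisym (≤-trans x≤y (≤-reflexive y≈0)) 0≤x)

  1-positive : Positive 1#
  1-positive = 0≤1 , 1≉0

  ⁻¹-nonNeg : ∀ {x} → Positive x → 0# ≤ x ⁻¹
  ⁻¹-nonNeg {x} (0≤x , x≉0) with ≤-total 0# (x ⁻¹)
  ... | inj₁ 0≤x⁻¹ = 0≤x⁻¹
  ... | inj₂ x⁻¹≤0 = contradiction (antisym 1≤0 0≤1) 1≉0
    where
    1≤0 : 1# ≤ 0#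
    1≤0 = begin
      1#        ≈⟨ *-inverseʳ x≉0 ⟨
      x * x ⁻¹  ≤⟨ *-monoˡ-≤ 0≤x x⁻¹≤0 ⟩
      x * 0#    ≈⟨ zeroʳ x ⟩
      0#        ∎

  ⁻¹-positive : ∀ {x} → Positive x → Positive (x ⁻¹)
  ⁻¹-positive {x} x>0 = ⁻¹-nonNeg x>0 , λ x⁻¹≈0 →
    1≉0 (trans (sym (*-inverseʳ (proj₂ x>0))) (trans (*-congˡ x⁻¹≈0) (zeroʳ x)))

  *-positive : ∀ {x y} → Positive x → Positive y → Positive (x * y)
  *-positive {x} {y} x>0 y>0 = *-nonNeg (proj₁ x>0) (proj₁ y>0) , λ xy≈0 →
    proj₂ x>0 (begin-equality
      x                ≈⟨ *-identityʳ x ⟨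
      x * 1#           ≈⟨ *-congˡ (*-inverseʳ (proj₂ y>0)) ⟨
      x * (y * y ⁻¹)   ≈⟨ *-assoc x y _ ⟨
      x * y * y ⁻¹     ≈⟨ *-congʳ xy≈0 ⟩
      0# * y ⁻¹        ≈⟨ zeroˡ _ ⟩
      0#               ∎)

  ⁻¹-unique : ∀ {x y} → Positive x → x * y ≈ 1# → y ≈ x ⁻¹
  ⁻¹-unique {x} {y} x>0 xy≈1 = begin-equality
    y                ≈⟨ *-identityʳ y ⟨
    y * 1#           ≈⟨ *-congˡ (*-inverseʳ (proj₂ x>0)) ⟨
    y * (x * x ⁻¹)   ≈⟨ solve 3 (λ x y z → y :* (x :* z) := (x :* y) :* z) refl x y (x ⁻¹) ⟩
    x * y * x ⁻¹     ≈⟨ *-congʳ xy≈1 ⟩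
    1# * x ⁻¹        ≈⟨ *-identityˡ _ ⟩
    x ⁻¹             ∎

  ⁻¹-* : ∀ {x y} → Positive x → Positive y → (x * y) ⁻¹ ≈ x ⁻¹ * y ⁻¹
  ⁻¹-* {x} {y} x>0 y>0 = sym (⁻¹-unique (*-positive x>0 y>0) (begin-equality
    x * y * (x ⁻¹ * y ⁻¹)
      ≈⟨ solve 4 (λ x y z w → (x :* y) :* (z :* w) := (x :* z) :* (y :* w)) refl x y (x ⁻¹) (y ⁻¹) ⟩
    (x * x ⁻¹) * (y * y ⁻¹)
      ≈⟨ *-cong (*-inverseʳ (proj₂ x>0)) (*-inverseʳ (proj₂ y>0)) ⟩
    1# * 1#
      ≈⟨ *-identityˡ 1# ⟩
    1# ∎))

  /-* : ∀ {y} x → Positive y → x / y * y ≈ x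
  /-* {y} x y>0 = begin-equality
    x * y ⁻¹ * y     ≈⟨ *-assoc _ _ _ ⟩
    x * (y ⁻¹ * y)   ≈⟨ *-congˡ (trans (*-comm _ _) (*-inverseʳ (proj₂ y>0))) ⟩
    x * 1#           ≈⟨ *-identityʳ x ⟩
    x                ∎

  fromℕ-nonNeg : ∀ m → 0# ≤ fromℕ m
  fromℕ-nonNeg zero    = ≤-refl
  fromℕ-nonNeg (suc m) = +-nonNeg 0≤1 (fromℕ-nonNeg m)

  fromℕ-positive : ∀ m → 1 ℕ.≤ m → Positive (fromℕ m)
  fromℕ-positive (suc m) _ = positive-≤ 1-positive (begin
    1#            ≈⟨ +-identityʳ 1# ⟨
    1# + 0#       ≤⟨ +-monoʳ-≤ 1# (fromℕ-nonNeg m) ⟩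
    1# + fromℕ m  ∎)

  fromℕ-mono-≤ : ∀ {m n} → m ℕ.≤ n → fromℕ m ≤ fromℕ n
  fromℕ-mono-≤ {n = n} ℕ.z≤n = fromℕ-nonNeg n
  fromℕ-mono-≤ (ℕ.s≤s m≤n)   = +-monoʳ-≤ 1# (fromℕ-mono-≤ m≤n)

  δ≤½⇒1-δ-positive : ∀ {δ} → δ ≤ 1# / fromℕ 2 → Positive (1# - δ)
  δ≤½⇒1-δ-positive {δ} δ≤½ = positive-≤ ½-positive (≤-minus (begin
    δ + ½          ≤⟨ +-mono-≤ δ≤½ ≤-refl ⟩
    ½ + ½          ≈⟨ solve 1 (λ h → h :+ h := h :* (con 1 :+ (con 1 :+ con 0))) refl ½ ⟩
    ½ * fromℕ 2    ≈⟨ /-* 1# 2-positive ⟩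
    1#             ∎))
    where
    ½ = 1# / fromℕ 2

    2-positive : Positive (fromℕ 2)
    2-positive = fromℕ-positive 2 (ℕ.s≤s ℕ.z≤n)

    ½-positive : Positive ½
    ½-positive = *-positive 1-positive (⁻¹-positive 2-positive)

  -- Finite sums and indicators.

  ∑-cong : ∀ {b} {B : Set b} (xs : List B) {f g : B → Carrier} →
           (∀ x → f x ≈ g x) → ∑ xs f ≈ ∑ xs g
  ∑-cong []       eq = refl
  ∑-cong (x ∷ xs) eq = +-cong (eq x) (∑-cong xs eq)

  ∑-mono : ∀ {b} {B : Set b} (xs : List B) {f g : B → Carrier} →
           All (λ x → f x ≤ g x) xs → ∑ xs f ≤ ∑ xs g
  ∑-mono []       []         = ≤-refl
  ∑-mono (x ∷ xs) (le ∷ les) = +-mono-≤ le (∑-mono xs les)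

  ∑-mono′ : ∀ {b} {B : Set b} (xs : List B) {f g : B → Carrier} →
            (∀ x → f x ≤ g x) → ∑ xs f ≤ ∑ xs g
  ∑-mono′ xs le = ∑-mono xs (All.universal le xs)

  ∑-nonNeg : ∀ {b} {B : Set b} (xs : List B) {f : B → Carrier} →
             (∀ x → 0# ≤ f x) → 0# ≤ ∑ xs f
  ∑-nonNeg []       nn = ≤-refl
  ∑-nonNeg (x ∷ xs) nn = +-nonNeg (nn x) (∑-nonNeg xs nn)

  ∑-++ : ∀ {b} {B : Set b} (xs ys : List B) (f : B → Carrier) →
         ∑ (xs ++ ys) f ≈ ∑ xs f + ∑ ys f
  ∑-++ []       ys f = sym (+-identityˡ _)
  ∑-++ (x ∷ xs) ys f = trans (+-congˡ (∑-++ xs ys f)) (sym (+-assoc _ _ _))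

  ∑-map : ∀ {b b′} {B : Set b} {B′ : Set b′} (h : B → B′) (xs : List B) (f : B′ → Carrier) →
          ∑ (map h xs) f ≈ ∑ xs (f ∘ h)
  ∑-map h []       f = refl
  ∑-map h (x ∷ xs) f = +-congˡ (∑-map h xs f)

  ∑-+ : ∀ {b} {B : Set b} (xs : List B) (f g : B → Carrier) →
        ∑ xs (λ x → f x + g x) ≈ ∑ xs f + ∑ xs g
  ∑-+ []       f g = sym (+-identityˡ 0#)
  ∑-+ (x ∷ xs) f g = trans (+-congˡ (∑-+ xs f g))
    (solve 4 (λ a b c d → (a :+ b) :+ (c :+ d) := (a :+ c) :+ (b :+ d)) refl _ _ _ _)

  ∑-*ˡ : ∀ {b} {B : Set b} z (xs : List B) (f : B → Carrier) →
         ∑ xs (λ x → z * f x) ≈ z * ∑ xs f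
  ∑-*ˡ z []       f = sym (zeroʳ z)
  ∑-*ˡ z (x ∷ xs) f = trans (+-congˡ (∑-*ˡ z xs f)) (sym (distribˡ _ _ _))

  ∑-*ʳ : ∀ {b} {B : Set b} z (xs : List B) (f : B → Carrier) →
         ∑ xs (λ x → f x * z) ≈ ∑ xs f * z
  ∑-*ʳ z []       f = sym (zeroˡ z)
  ∑-*ʳ z (x ∷ xs) f = trans (+-congˡ (∑-*ʳ z xs f)) (sym (distribʳ _ _ _))

  ∑-0 : ∀ {b} {B : Set b} (xs : List B) → ∑ xs (λ _ → 0#) ≈ 0#
  ∑-0 []       = refl
  ∑-0 (x ∷ xs) = trans (+-identityˡ _) (∑-0 xs)

  ∑-swap : ∀ {b b′} {B : Set b} {B′ : Set b′} (xs : List B) (ys : List B′) (f : B → B′ → Carrier) →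
           ∑[ x ∈ xs ] ∑[ y ∈ ys ] f x y ≈ ∑[ y ∈ ys ] ∑[ x ∈ xs ] f x y
  ∑-swap []       ys f = sym (∑-0 ys)
  ∑-swap (x ∷ xs) ys f = trans (+-congˡ (∑-swap xs ys f)) (sym (∑-+ ys (f x) _))

  ∑-cartesianProductWith :
    ∀ {b b′ b″} {B : Set b} {B′ : Set b′} {B″ : Set b″}
    (h : B → B′ → B″) (xs : List B) (ys : List B′) (f : B″ → Carrier) →
    ∑ (cartesianProductWith h xs ys) f ≈ ∑[ x ∈ xs ] ∑[ y ∈ ys ] f (h x y)
  ∑-cartesianProductWith h []       ys f = refl
  ∑-cartesianProductWith h (x ∷ xs) ys f =
    trans (∑-++ (map (h x) ys) _ f)
          (+-cong (∑-map (h x) ys f) (∑-cartesianProductWith h xs ys f))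

  -- Induction on `xs`: one occurrence of the head is deleted from `ys`, and uniqueness keeps the
  -- tail of `xs` inside what is left. This is how a sum over the fixed sets that occur becomes a
  -- sum over all subsets.
  ∑-⊆ : ∀ {b} {B : Set b} {xs ys : List B} {f : B → Carrier} → (∀ x → 0# ≤ f x) →
        Unique xs → xs ⊆ ys → ∑ xs f ≤ ∑ ys f
  ∑-⊆ {xs = []}     {ys} nn _          _     = ∑-nonNeg ys nn
  ∑-⊆ {xs = x ∷ xs} {ys} {f} nn (x∉xs ∷ u) xs⊆ys with ∈-∃++ (xs⊆ys (here ≡.refl))
  ... | as , bs , ≡.refl = begin
    f x + ∑ xs f             ≤⟨ +-monoʳ-≤ (f x) (∑-⊆ nn u xs⊆as++bs) ⟩
    f x + ∑ (as ++ bs) f     ≈⟨ +-congˡ (∑-++ as bs f) ⟩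
    f x + (∑ as f + ∑ bs f)  ≈⟨ solve 3 (λ a b c → a :+ (b :+ c) := b :+ (a :+ c)) refl _ _ _ ⟩
    ∑ as f + (f x + ∑ bs f)  ≈⟨ ∑-++ as (x ∷ bs) f ⟨
    ∑ (as ++ x ∷ bs) f       ∎
    where
    xs⊆as++bs : xs ⊆ as ++ bs
    xs⊆as++bs z∈xs with ∈-++⁻ as (xs⊆ys (there z∈xs))
    ... | inj₁ z∈as           = ∈-++⁺ˡ z∈as
    ... | inj₂ (here ≡.refl)  = contradiction ≡.refl (All.lookup x∉xs z∈xs)
    ... | inj₂ (there z∈bs)   = ∈-++⁺ʳ as z∈bs

  -- In `measure` and `α` membership is expressed by filtering; as a factor 0 or 1 it can be carried
  -- through sums whose order is exchanged.
  𝟙 : ∀ {p} {P : Set p} → Dec P → Carrier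
  𝟙 P? = if does P? then 1# else 0#

  𝟙-nonNeg : ∀ {p} {P : Set p} (P? : Dec P) → 0# ≤ 𝟙 P?
  𝟙-nonNeg (yes _) = 0≤1
  𝟙-nonNeg (no _)  = ≤-refl

  𝟙-mono : ∀ {p q} {P : Set p} {Q : Set q} (P? : Dec P) (Q? : Dec Q) → (P → Q) → 𝟙 P? ≤ 𝟙 Q?
  𝟙-mono (yes p) (yes _)  f = ≤-refl
  𝟙-mono (yes p) (no ¬q)  f = contradiction (f p) ¬q
  𝟙-mono (no _)  Q?       f = 𝟙-nonNeg Q?

  𝟙-× : ∀ {p q} {P : Set p} {Q : Set q} (P? : Dec P) (Q? : Dec Q) →
        𝟙 (P? ×-dec Q?) ≈ 𝟙 P? * 𝟙 Q?
  𝟙-× (yes _) Q? = sym (*-identityˡ _)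
  𝟙-× (no _)  Q? = sym (zeroˡ _)

  -- The union bound at a single point.
  𝟙-any? : ∀ {b p} {B : Set b} {P : Pred B p} (P? : Decidable P) (xs : List B) →
           𝟙 (Any.any? P? xs) ≤ ∑[ x ∈ xs ] 𝟙 (P? x)
  𝟙-any? P? []       = ≤-refl
  𝟙-any? P? (x ∷ xs) with P? x
  ... | no _  = ≤-trans (𝟙-any? P? xs) (≤-reflexive (sym (+-identityˡ _)))
  ... | yes _ = ≤-trans (≤-reflexive (sym (+-identityʳ 1#)))
                        (+-monoʳ-≤ 1# (∑-nonNeg xs (𝟙-nonNeg ∘ P?)))

  ∑-filter : ∀ {b p} {B : Set b} {P : Pred B p} (P? : Decidable P) (xs : List B) (f : B → Carrier) →
             ∑ (filter P? xs) f ≈ ∑[ x ∈ xs ] (𝟙 (P? x) * f x)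
  ∑-filter P? []       f = refl
  ∑-filter P? (x ∷ xs) f with P? x
  ... | yes _ = +-cong (sym (*-identityˡ _)) (∑-filter P? xs f)
  ... | no _  = trans (∑-filter P? xs f) (trans (sym (+-identityˡ _)) (+-congʳ (sym (zeroˡ _))))

  ∑-1 : ∀ {b} {B : Set b} (xs : List B) → ∑ xs (λ _ → 1#) ≈ fromℕ (length xs)
  ∑-1 []       = refl
  ∑-1 (x ∷ xs) = +-congˡ (∑-1 xs)

  length-filter-𝟙 : ∀ {b p} {B : Set b} {P : Pred B p} (P? : Decidable P) (xs : List B) →
                    fromℕ (length (filter P? xs)) ≈ ∑[ x ∈ xs ] 𝟙 (P? x)
  length-filter-𝟙 P? xs = begin-equality
    fromℕ (length (filter P? xs))  ≈⟨ ∑-1 (filter P? xs) ⟨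
    ∑ (filter P? xs) (λ _ → 1#)    ≈⟨ ∑-filter P? xs _ ⟩
    ∑[ x ∈ xs ] (𝟙 (P? x) * 1#)    ≈⟨ ∑-cong xs (λ x → *-identityʳ _) ⟩
    ∑[ x ∈ xs ] 𝟙 (P? x)           ∎

  -- The entries equal to `z` form a duplicate-free list contained in `z ∷ []`.
  ∑-𝟙-≟ : ∀ {m} (z : Fin m) (f : Fin m → Carrier) → (∀ y → 0# ≤ f y) →
          ∑[ y ∈ allFin m ] (𝟙 (y Fin.≟ z) * f y) ≤ f z
  ∑-𝟙-≟ {m} z f nn = begin
    ∑[ y ∈ allFin m ] (𝟙 (y Fin.≟ z) * f y)  ≈⟨ ∑-filter (Fin._≟ z) (allFin m) f ⟨
    ∑ (filter (Fin._≟ z) (allFin m)) f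
      ≤⟨ ∑-⊆ {ys = z ∷ []} nn (Unique.filter⁺ (Fin._≟ z) (Unique.allFin⁺ m))
             (here ∘ proj₂ ∘ ∈-filter⁻ (Fin._≟ z) {xs = allFin m}) ⟩
    f z + 0#                                 ≈⟨ +-identityʳ _ ⟩
    f z                                      ∎

  length-filter-¬ : ∀ {b p} {B : Set b} {P : Pred B p} (P? : Decidable P) (xs : List B) →
    fromℕ (length (filter P? xs)) + fromℕ (length (filter (¬? ∘ P?) xs)) ≈ fromℕ (length xs)
  length-filter-¬ P? []       = +-identityˡ 0#
  length-filter-¬ P? (x ∷ xs) with P? x
  ... | yes _ = trans (+-assoc _ _ _) (+-congˡ (length-filter-¬ P? xs))
  ... | no _  = trans (solve 3 (λ a b c → a :+ (b :+ c) := b :+ (a :+ c)) refl _ _ _)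
                      (+-congˡ (length-filter-¬ P? xs))

  ∑-if : ∀ {b p} {B : Set b} {P : Pred B p} (P? : Decidable P) (xs : List B) u v →
    ∑[ x ∈ xs ] (if does (P? x) then u else v)
      ≈ fromℕ (length (filter P? xs)) * u + fromℕ (length (filter (¬? ∘ P?) xs)) * v
  ∑-if P? []       u v = sym (trans (+-cong (zeroˡ u) (zeroˡ v)) (+-identityˡ 0#))
  ∑-if P? (x ∷ xs) u v with P? x
  ... | yes _ = trans (+-congˡ (∑-if P? xs u v))
    (solve 4 (λ p q u v → u :+ (p :* u :+ q :* v) := (con 1 :+ p) :* u :+ q :* v) refl _ _ u v)
  ... | no _  = trans (+-congˡ (∑-if P? xs u v))
    (solve 4 (λ p q u v → v :+ (p :* u :+ q :* v) := p :* u :+ (con 1 :+ q) :* v) refl _ _ u v)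

  -- Reweighting a single fibre.

  fromℕ-zero-or-positive : ∀ m → fromℕ m ≈ 0# ⊎ Positive (fromℕ m)
  fromℕ-zero-or-positive zero    = inj₁ refl
  fromℕ-zero-or-positive (suc m) = inj₂ (fromℕ-positive (suc m) (ℕ.s≤s ℕ.z≤n))

  -- Abstracts `factor`: the fibre S_k becomes a list xs, and B_k a predicate P on it.
  module Reweighting
    {b p} {Y : Set b} {P : Pred Y p} (P? : Decidable P) (xs : List Y)
    {N : ℕ} (length≡N : length xs ≡ N) (1≤N : 1 ℕ.≤ N)
    {δ : Carrier} (0≤δ : 0# ≤ δ) (1-δ>0 : Positive (1# - δ))
    where

    S bad good α : Carrier
    S    = fromℕ N
    bad  = fromℕ (length (filter P? xs))
    good = fromℕ (length (filter (¬? ∘ P?) xs))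
    α    = bad / S

    ifBad ifGood : Carrier
    ifBad  = max 0# ((α - δ) / (α * (1# - δ)))
    ifGood = min (1# / (1# - α)) (1# / (1# - δ))

    multiplier : Y → Carrier
    multiplier y = if does (P? y) then ifBad else ifGood

    S>0 : Positive S
    S>0 = fromℕ-positive N 1≤N

    0≤good : 0# ≤ good
    0≤good = fromℕ-nonNeg (length (filter (¬? ∘ P?) xs))

    α*S≈bad : α * S ≈ bad
    α*S≈bad = /-* bad S>0

    [1-α]*S≈good : (1# - α) * S ≈ good
    [1-α]*S≈good = +-cancelˡ bad _ _ (begin-equality
      bad + (1# - α) * S      ≈⟨ +-congʳ α*S≈bad ⟨
      α * S + (1# - α) * S    ≈⟨ distribʳ _ _ _ ⟨
      (α + (1# - α)) * S      ≈⟨ *-congʳ (x+[y-x]≈y α 1#) ⟩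
      1# * S                  ≈⟨ *-identityˡ S ⟩
      S                       ≡⟨ ≡.cong fromℕ length≡N ⟨
      fromℕ (length xs)       ≈⟨ length-filter-¬ P? xs ⟨
      bad + good              ∎)

    0≤1/[1-δ] : 0# ≤ 1# / (1# - δ)
    0≤1/[1-δ] = *-nonNeg 0≤1 (⁻¹-nonNeg 1-δ>0)

    α-positive : Positive bad → Positive α
    α-positive bad>0 = *-positive bad>0 (⁻¹-positive S>0)

    quotient-α : Positive α → (α * (1# - δ)) ⁻¹ ≈ α ⁻¹ * (1# - δ) ⁻¹
    quotient-α α>0 = ⁻¹-* α>0 1-δ>0

    cancel-α : Positive α → ∀ z → α * (α ⁻¹ * z) ≈ z
    cancel-α α>0 z = trans (sym (*-assoc _ _ _))
                       (trans (*-congʳ (*-inverseʳ (proj₂ α>0))) (*-identityˡ z))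

    -- A good point `y` in the list makes `good`, hence `1# - α`, positive; so `(1# - α) ⁻¹` is not
    -- the unspecified inverse of 0.
    multiplier-nonNeg : ∀ {y} → y ∈ xs → 0# ≤ multiplier y
    multiplier-nonNeg {y} y∈xs with P? y
    ... | yes _ = x≤x⊔y 0# _
    ... | no ¬p = ⊓-glb (*-nonNeg 0≤1 (⁻¹-nonNeg 1-α>0)) 0≤1/[1-δ]
      where
      good>0 : Positive good
      good>0 = fromℕ-positive _ (filter-some (¬? ∘ P?) (Any.map (λ { ≡.refl → ¬p }) y∈xs))

      1-α>0 : Positive (1# - α)
      1-α>0 = positive-≤ (*-positive good>0 (⁻¹-positive S>0)) (≤-reflexive (begin-equality
        good * S ⁻¹             ≈⟨ *-congʳ [1-α]*S≈good ⟨
        (1# - α) * S * S ⁻¹     ≈⟨ *-assoc _ _ _ ⟩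
        (1# - α) * (S * S ⁻¹)   ≈⟨ *-congˡ (*-inverseʳ (proj₂ S>0)) ⟩
        (1# - α) * 1#           ≈⟨ *-identityʳ _ ⟩
        1# - α                  ∎))

    -- On a good point the minimum is at most its second entry. A bad point makes α positive, and
    -- then (α - δ)/α is at most 1 because δ is nonnegative.
    multiplier-≤ : ∀ {y} → y ∈ xs → multiplier y ≤ 1# / (1# - δ)
    multiplier-≤ {y} y∈xs with P? y
    ... | no _  = x⊓y≤y _ _
    ... | yes p = ⊔-lub 0≤1/[1-δ] (begin
        (α - δ) * (α * (1# - δ)) ⁻¹       ≤⟨ *-monoʳ-≤ (⁻¹-nonNeg (*-positive α>0 1-δ>0)) α-δ≤α ⟩
        α * (α * (1# - δ)) ⁻¹             ≈⟨ *-congˡ (quotient-α α>0) ⟩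
        α * (α ⁻¹ * (1# - δ) ⁻¹)          ≈⟨ cancel-α α>0 _ ⟩
        (1# - δ) ⁻¹                       ≈⟨ *-identityˡ _ ⟨
        1# / (1# - δ)                     ∎)
      where
      α>0 : Positive α
      α>0 = α-positive (fromℕ-positive _ (filter-some P? (Any.map (λ { ≡.refl → p }) y∈xs)))

      α-δ≤α : α - δ ≤ α
      α-δ≤α = +-cancelˡ-≤ δ (begin
        δ + (α - δ)   ≈⟨ x+[y-x]≈y δ α ⟩
        α             ≈⟨ +-identityˡ α ⟨
        0# + α        ≤⟨ +-mono-≤ 0≤δ ≤-refl ⟩
        δ + α         ∎)

    -- The bad points lose all their mass, since α - δ is nonpositive, and the (1 - α)S good points
    -- carry at most 1/(1 - α) each.
    total-if-α≤δ : α ≤ δ → bad * ifBad + good * ifGood ≤ S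
    total-if-α≤δ α≤δ = begin
      bad * ifBad + good * ifGood   ≤⟨ +-mono-≤ bad*ifBad≤0 good*ifGood≤S ⟩
      0# + S                        ≈⟨ +-identityˡ S ⟩
      S                             ∎
      where
      1-α>0 : Positive (1# - α)
      1-α>0 = positive-≤ 1-δ>0 (-‿anti-mono 1# α≤δ)

      bad*ifBad≤0 : bad * ifBad ≤ 0#
      bad*ifBad≤0 with fromℕ-zero-or-positive (length (filter P? xs))
      -- The quotient inside `ifBad` now inverts 0; the factor `bad` makes its value immaterial.
      ... | inj₁ bad≈0 = ≤-reflexive (trans (*-congʳ bad≈0) (zeroˡ _))
      ... | inj₂ bad>0 = begin
        bad * ifBad   ≤⟨ *-monoˡ-≤ (proj₁ bad>0) (⊔-lub ≤-refl (begin
            (α - δ) * (α * (1# - δ)) ⁻¹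
              ≤⟨ *-monoʳ-≤ (⁻¹-nonNeg (*-positive (α-positive bad>0) 1-δ>0))
                           (+-mono-≤ α≤δ ≤-refl) ⟩
            (δ - δ) * (α * (1# - δ)) ⁻¹
              ≈⟨ trans (*-congʳ (-‿inverseʳ δ)) (zeroˡ _) ⟩
            0# ∎)) ⟩
        bad * 0#      ≈⟨ zeroʳ bad ⟩
        0#            ∎

      good*ifGood≤S : good * ifGood ≤ S
      good*ifGood≤S = begin
        good * ifGood                         ≤⟨ *-monoˡ-≤ 0≤good (x⊓y≤x _ _) ⟩
        good * (1# * (1# - α) ⁻¹)             ≈⟨ *-congʳ [1-α]*S≈good ⟨
        (1# - α) * S * (1# * (1# - α) ⁻¹)
          ≈⟨ solve 3 (λ r s i → r :* s :* (con 1 :* i) := r :* i :* s) refl _ _ _ ⟩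
        (1# - α) * (1# - α) ⁻¹ * S            ≈⟨ *-congʳ (*-inverseʳ (proj₂ 1-α>0)) ⟩
        1# * S                                ≈⟨ *-identityˡ S ⟩
        S                                     ∎

    -- After division by S the bad points contribute (α - δ)/(1 - δ) and the good ones at most (1 -
    -- α)/(1 - δ); these add up to 1.
    total-if-δ≤α : δ ≤ α → Positive bad → bad * ifBad + good * ifGood ≤ S
    total-if-δ≤α δ≤α bad>0 = begin
      bad * ifBad + good * ifGood
        ≤⟨ +-mono-≤ (*-monoˡ-≤ (proj₁ bad>0) ifBad≤) (*-monoˡ-≤ 0≤good (x⊓y≤y _ _)) ⟩
      bad * ((α - δ) * (α * (1# - δ)) ⁻¹) + good * (1# * (1# - δ) ⁻¹)
        ≈⟨ +-cong (*-cong (sym α*S≈bad) (*-congˡ (quotient-α α>0))) (*-congʳ (sym [1-α]*S≈good)) ⟩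
      α * S * ((α - δ) * (α ⁻¹ * (1# - δ) ⁻¹)) + (1# - α) * S * (1# * (1# - δ) ⁻¹)
        ≈⟨ solve 6 (λ x s d i r e →
             x :* s :* (d :* (i :* e)) :+ r :* s :* (con 1 :* e)
               := x :* (i :* (d :* (s :* e))) :+ r :* (s :* e)) refl α S (α - δ) (α ⁻¹) (1# - α) _ ⟩
      α * (α ⁻¹ * ((α - δ) * (S * (1# - δ) ⁻¹))) + (1# - α) * (S * (1# - δ) ⁻¹)
        ≈⟨ +-congʳ (cancel-α α>0 _) ⟩
      (α - δ) * (S * (1# - δ) ⁻¹) + (1# - α) * (S * (1# - δ) ⁻¹)
        ≈⟨ solve 5 (λ x d m s e →
             (x :+ d) :* (s :* e) :+ (con 1 :+ m) :* (s :* e)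
               := (x :+ ((con 1 :+ d) :+ m)) :* e :* s) refl α (- δ) (- α) S _ ⟩
      (α + ((1# - δ) - α)) * (1# - δ) ⁻¹ * S
        ≈⟨ *-congʳ (*-congʳ (x+[y-x]≈y α (1# - δ))) ⟩
      (1# - δ) * (1# - δ) ⁻¹ * S
        ≈⟨ *-congʳ (*-inverseʳ (proj₂ 1-δ>0)) ⟩
      1# * S
        ≈⟨ *-identityˡ S ⟩
      S ∎
      where
      α>0 : Positive α
      α>0 = α-positive bad>0

      ifBad≤ : ifBad ≤ (α - δ) * (α * (1# - δ)) ⁻¹
      ifBad≤ = ⊔-lub (*-nonNeg (0≤y-x δ≤α) (⁻¹-nonNeg (*-positive α>0 1-δ>0))) ≤-refl

    ∑-multiplier-≤ : ∑ xs multiplier ≤ S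
    ∑-multiplier-≤ = ≤-trans (≤-reflexive (∑-if P? xs ifBad ifGood)) total-≤
      where
      total-≤ : bad * ifBad + good * ifGood ≤ S
      -- Equality in `K` is not assumed decidable, so the split on `bad` is made on the natural
      -- number behind it.
      total-≤ with fromℕ-zero-or-positive (length (filter P? xs)) | ≤-total α δ
      ... | _          | inj₁ α≤δ = total-if-α≤δ α≤δ
      ... | inj₂ bad>0 | inj₂ δ≤α = total-if-δ≤α δ≤α bad>0
      -- Without bad points α is 0, hence at most δ, and the first case applies again.
      ... | inj₁ bad≈0 | inj₂ _   =
        total-if-α≤δ (≤-trans (≤-reflexive (trans (*-congʳ bad≈0) (zeroˡ _))) 0≤δ)

  -- Maxima over lists, and powers.

  ≤-foldr-max : ∀ {x} {xs : List Carrier} → x ∈ xs → x ≤ foldr max 0# xs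
  ≤-foldr-max (here ≡.refl)  = x≤x⊔y _ _
  ≤-foldr-max (there x∈xs)   = ≤-trans (≤-foldr-max x∈xs) (x≤y⊔x _ _)

  foldr-max-≤ : ∀ {z} (xs : List Carrier) → 0# ≤ z → All (_≤ z) xs → foldr max 0# xs ≤ z
  foldr-max-≤ []       0≤z []         = 0≤z
  foldr-max-≤ (x ∷ xs) 0≤z (le ∷ les) = ⊔-lub le (foldr-max-≤ xs 0≤z les)

  0≤foldr-max : ∀ xs → 0# ≤ foldr max 0# xs
  0≤foldr-max []       = ≤-refl
  0≤foldr-max (x ∷ xs) = ≤-trans (0≤foldr-max xs) (x≤y⊔x _ _)

  1^m≈1 : ∀ m → 1# ^ m ≈ 1#
  1^m≈1 zero    = refl
  1^m≈1 (suc m) = trans (*-identityˡ _) (1^m≈1 m)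

  [x^2]⁻¹ : ∀ {x} → Positive x → (x ^ 2) ⁻¹ ≈ x ⁻¹ * x ⁻¹
  [x^2]⁻¹ {x} x>0 = trans (⁻¹-cong (*-congˡ (*-identityʳ x))) (⁻¹-* x>0 x>0)

-- Completeness of the listings of hyperplanes and subsets.

∈-tuples : ∀ {T : ℕ → Set} {ts : ∀ j → List (T j)} → (∀ j (t : T j) → t ∈ ts j) →
           ∀ {k} (t : Tuple T k) → t ∈ tuples ts k
∈-tuples all []      = here ≡.refl
∈-tuples all (t ▸ x) = ∈-cartesianProductWith⁺ _▸_ (∈-tuples all t) (all _ x)

∈-hyperplanes : ∀ {s k} (H : Hyperplane s k) → H ∈ hyperplanes s k
∈-hyperplanes = ∈-tuples λ where
  j nothing  → here ≡.refl
  j (just y) → there (∈-map⁺ just (∈-allFin y))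

∈-subsets : ∀ {k} (G : Subset k) → G ∈ subsets k
∈-subsets Vec.[]              = here ≡.refl
∈-subsets (outside Vec.∷ G)   = ∈-++⁺ˡ (∈-map⁺ (outside Vec.∷_) (∈-subsets G))
∈-subsets (inside Vec.∷ G)    = ∈-++⁺ʳ (map (outside Vec.∷_) (subsets _)) (∈-map⁺ (inside Vec.∷_) (∈-subsets G))

-- Built by the recursion of `subsets`, so that putting ⊥ in front gives back the very same list in
-- the same order and the term at ⊥ splits off from a sum.
nonempties : ∀ k → List (Subset k)
nonempties zero    = []
nonempties (suc k) = map (outside Vec.∷_) (nonempties k) ++ map (inside Vec.∷_) (subsets k)

subsets≡⊥∷nonempties : ∀ k → subsets k ≡ ⊥ ∷ nonempties k
subsets≡⊥∷nonempties zero    = ≡.refl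
subsets≡⊥∷nonempties (suc k) =
  ≡.cong (λ Gs → map (outside Vec.∷_) Gs ++ map (inside Vec.∷_) (subsets k)) (subsets≡⊥∷nonempties k)

∈-nonempties : ∀ {k} (G : Subset k) → G ≢ ⊥ → G ∈ nonempties k
∈-nonempties {k} G G≢⊥ with ≡.subst (G ∈_) (subsets≡⊥∷nonempties k) (∈-subsets G)
... | here G≡⊥  = contradiction G≡⊥ G≢⊥
... | there G∈  = G∈

-- Meets of hyperplanes, and the fixed sets of the traces.

module _ {s : ℕ → ℕ} where

  init : ∀ {k} → Hyperplane s (suc k) → Hyperplane s k
  init (A ▸ _) = A

  -- Where both hyperplanes fix a coordinate, `<∣>` keeps the value of the first; a clash of values
  -- therefore needs no separate case.
  meet : ∀ {k} → Hyperplane s k → Hyperplane s k → Hyperplane s k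
  meet []      []        = []
  meet (A ▸ m) (A′ ▸ m′) = meet A A′ ▸ (m <∣> m′)

  F-meet : ∀ {k} (A A′ : Hyperplane s k) → F (meet A A′) ≡ F A ∪ F A′
  F-meet []            []        = ≡.refl
  F-meet (A ▸ nothing) (A′ ▸ m′) = ≡.cong (is-just m′ Vec.∷_) (F-meet A A′)
  F-meet (A ▸ just _)  (A′ ▸ m′) = ≡.cong (inside Vec.∷_) (F-meet A A′)

  -- Only one inclusion holds: `meet` is a hyperplane even where A and A′ are disjoint.
  ∈ᴴ-meet : ∀ {k} (x : Q s k) (A A′ : Hyperplane s k) → x ∈ᴴ A → x ∈ᴴ A′ → x ∈ᴴ meet A A′
  ∈ᴴ-meet []      []            []        _         _           = tt
  ∈ᴴ-meet (x ▸ y) (A ▸ nothing) (A′ ▸ m′) (x∈ , _)  (x∈′ , y∈′) = ∈ᴴ-meet x A A′ x∈ x∈′ , y∈′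
  ∈ᴴ-meet (x ▸ y) (A ▸ just _)  (A′ ▸ m′) (x∈ , y∈) (x∈′ , _)   = ∈ᴴ-meet x A A′ x∈ x∈′ , y∈

  -- Phrased through `F`, so that it transfers both distinctness and cardinality between a
  -- hyperplane and its trace.
  FixesLast : ∀ {k} → Hyperplane s (suc k) → Set
  FixesLast A = F A ≡ inside Vec.∷ F (init A)

  inQ-self : ∀ {k} (A : Hyperplane s k) → inQ k A ≡ just A
  inQ-self {k} A rewrite ℕ.≟-diag {k} ≡.refl = ≡.refl

  inQ-≤ : ∀ {k n} (A : Hyperplane s n) {A′} → inQ k A ≡ just A′ → k ℕ.≤ n
  inQ-≤ {k} {n} A eq with n ℕ.≟ k
  inQ-≤ A             eq | yes ≡.refl = ℕ.≤-refl
  inQ-≤ (A ▸ nothing) eq | no _       = ℕ.m≤n⇒m≤1+n (inQ-≤ A eq)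

  inQ-drop : ∀ {k m} (A : Hyperplane s m) → k ℕ.≤ m → inQ k (A ▸ nothing) ≡ inQ k A
  inQ-drop {k} {m} A k≤m with suc m ℕ.≟ k
  ... | yes ≡.refl = contradiction k≤m (ℕ.<-irrefl ≡.refl)
  ... | no _       = ≡.refl

  inQ-init : ∀ {k n} (A : Hyperplane s n) {A′ : Hyperplane s k} →
             inQ (suc k) A ≡ just (A′ ▸ nothing) → inQ k A ≡ just A′
  inQ-init {k} {n} A eq with n ℕ.≟ suc k
  inQ-init A             ≡.refl | yes ≡.refl = ≡.trans (inQ-drop _ ℕ.≤-refl) (inQ-self _)
  inQ-init (A ▸ nothing) eq     | no _       =
    ≡.trans (inQ-drop A (ℕ.<⇒≤ (inQ-≤ A eq))) (inQ-init A eq)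

  -- Viewing a hyperplane in Q_k drops only coordinates that it leaves free, so members of `𝒜`
  -- cannot become parallel on the way.
  F-inQ-injective : ∀ {k n} (A A₁ : Hyperplane s n) {A′ A₁′ : Hyperplane s k} →
                    inQ k A ≡ just A′ → inQ k A₁ ≡ just A₁′ → F A′ ≡ F A₁′ → F A ≡ F A₁
  F-inQ-injective {k} {n} A A₁ eq eq₁ F≡ with n ℕ.≟ k
  F-inQ-injective A A₁ ≡.refl ≡.refl F≡ | yes ≡.refl = F≡
  F-inQ-injective (A ▸ nothing) (A₁ ▸ nothing) eq eq₁ F≡ | no _ =
    ≡.cong (outside Vec.∷_) (F-inQ-injective A A₁ eq eq₁ F≡)

  -- If the last coordinate were free, `inQ-init` would make `A` visible in Q_k already, against the
  -- first equation.
  fixesLast : ∀ {k n} (A : Hyperplane s n) {A′ : Hyperplane s (suc k)} →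
              inQ k A ≡ nothing → inQ (suc k) A ≡ just A′ → FixesLast A′
  fixesLast A {A′ ▸ just _}  _  _   = ≡.refl
  fixesLast A {A′ ▸ nothing} eq eq′ = contradiction (≡.trans (≡.sym eq) (inQ-init A eq′)) λ ()

  𝒩-fixesLast : ∀ {n} (𝒜 : List (Hyperplane s n)) k → All FixesLast (𝒩 𝒜 k)
  𝒩-fixesLast []      k = []
  𝒩-fixesLast (A ∷ 𝒜) k with inQ k A in eq
  ... | just _  = 𝒩-fixesLast 𝒜 k
  ... | nothing with inQ (suc k) A in eq′
  ...   | nothing = 𝒩-fixesLast 𝒜 k
  ...   | just _  = fixesLast A eq eq′ ∷ 𝒩-fixesLast 𝒜 k

  𝒩-not-parallel-to : ∀ {n k} (A : Hyperplane s n) {A′} → inQ (suc k) A ≡ just A′ →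
                      (𝒜 : List (Hyperplane s n)) → All (λ A₁ → ¬ Parallel A A₁) 𝒜 →
                      All (λ A₁ → ¬ Parallel A′ A₁) (𝒩 𝒜 k)
  𝒩-not-parallel-to A eqA []       []       = []
  𝒩-not-parallel-to {k = k} A eqA (A₁ ∷ 𝒜) (A∦A₁ ∷ A∦) with inQ k A₁
  ... | just _  = 𝒩-not-parallel-to A eqA 𝒜 A∦
  ... | nothing with inQ (suc k) A₁ in eqA₁
  ...   | nothing = 𝒩-not-parallel-to A eqA 𝒜 A∦
  ...   | just _  = A∦A₁ ∘ F-inQ-injective A A₁ eqA eqA₁ ∷ 𝒩-not-parallel-to A eqA 𝒜 A∦

  𝒩-non-parallel : ∀ {n} (𝒜 : List (Hyperplane s n)) k → AllPairs (λ A A₁ → ¬ Parallel A A₁) 𝒜 →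
                   AllPairs (λ A A₁ → ¬ Parallel A A₁) (𝒩 𝒜 k)
  𝒩-non-parallel []      k []         = []
  𝒩-non-parallel (A ∷ 𝒜) k (A∦ ∷ 𝒜∦) with inQ k A
  ... | just _  = 𝒩-non-parallel 𝒜 k 𝒜∦
  ... | nothing with inQ (suc k) A in eq
  ...   | nothing = 𝒩-non-parallel 𝒜 k 𝒜∦
  ...   | just _  = 𝒩-not-parallel-to A eq 𝒜 A∦ ∷ 𝒩-non-parallel 𝒜 k 𝒜∦

  traces : ∀ {n} → List (Hyperplane s n) → ∀ k → List (Hyperplane s k)
  traces 𝒜 k = map init (𝒩 𝒜 k)

  supports : ∀ {n} → List (Hyperplane s n) → ∀ k → List (Subset k)
  supports 𝒜 k = map F (traces 𝒜 k)

  -- All entries fix the last coordinate, so traces with equal fixed sets would come from parallel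
  -- hyperplanes.
  F-init-unique : ∀ {k} {As : List (Hyperplane s (suc k))} → All FixesLast As →
                  AllPairs (λ A A₁ → ¬ Parallel A A₁) As → Unique (map F (map init As))
  F-init-unique                []             []          = []
  F-init-unique {As = A ∷ _}   (last ∷ lasts) (A∦ ∷ As∦) =
    All.map⁺ (All.map⁺ (All.zipWith distinct (lasts , A∦))) ∷ F-init-unique lasts As∦
    where
    distinct : ∀ {A₁} → FixesLast A₁ × ¬ Parallel A A₁ → F (init A) ≢ F (init A₁)
    distinct (last₁ , A∦A₁) eq =
      A∦A₁ (≡.trans last (≡.trans (≡.cong (inside Vec.∷_) eq) (≡.sym last₁)))

  supports-unique : ∀ {n} (𝒜 : List (Hyperplane s n)) k →
                    AllPairs (λ A A₁ → ¬ Parallel A A₁) 𝒜 → Unique (supports 𝒜 k)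
  supports-unique 𝒜 k 𝒜∦ = F-init-unique (𝒩-fixesLast 𝒜 k) (𝒩-non-parallel 𝒜 k 𝒜∦)

  -- A trace that fixes nothing comes from a hyperplane whose only fixed coordinate is the last one.
  supports-nonempty : ∀ {n} (𝒜 : List (Hyperplane s n)) k →
                      All (λ A → ∣ F A ∣ ≢ 1) (𝒩 𝒜 k) → All (_≢ ⊥) (supports 𝒜 k)
  supports-nonempty 𝒜 k F≢1 =
    All.map⁺ (All.map⁺ (All.zipWith nonempty (𝒩-fixesLast 𝒜 k , F≢1)))
    where
    nonempty : ∀ {A} → FixesLast A × ∣ F A ∣ ≢ 1 → F (init A) ≢ ⊥
    nonempty (last , ∣F∣≢1) F≡⊥ =
      ∣F∣≢1 (≡.trans (≡.cong ∣_∣ (≡.trans last (≡.cong (inside Vec.∷_) F≡⊥))) (≡.cong suc (∣⊥∣≡0 k)))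

-- Sums over pairs of subsets, grouped by their union.

module SubsetSums {c ℓ₁ ℓ₂} (K : OrderedField c ℓ₁ ℓ₂) where
  open OrderedField K
  open OrderedFieldProperties K
  open PartialOrderReasoning poset

  ∑-subsets-suc : ∀ m (g : Subset (suc m) → Carrier) →
    ∑ (subsets (suc m)) g
      ≈ ∑ (subsets m) (g ∘ (outside Vec.∷_)) + ∑ (subsets m) (g ∘ (inside Vec.∷_))
  ∑-subsets-suc m g = trans (∑-++ (map (outside Vec.∷_) (subsets m)) _ g)
                            (+-cong (∑-map _ (subsets m) g) (∑-map _ (subsets m) g))

  ∑-subsets-⊥ : ∀ m (g : Subset m → Carrier) → ∑ (subsets m) g ≈ g ⊥ + ∑ (nonempties m) g
  ∑-subsets-⊥ m g = reflexive (≡.cong (λ Gs → ∑ Gs g) (subsets≡⊥∷nonempties m))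

  -- A set H is the union of exactly 3 ^ ∣ H ∣ ordered pairs: each of its
  -- elements lies in the first set only, the second only, or both.
  ∑∑-subsets-∪ : ∀ m (g : Subset m → Carrier) →
    ∑[ G ∈ subsets m ] ∑[ H ∈ subsets m ] g (G ∪ H)
      ≈ ∑[ H ∈ subsets m ] (g H * fromℕ 3 ^ ∣ H ∣)
  ∑∑-subsets-∪ zero    g =
    solve 1 (λ x → (x :+ con 0) :+ con 0 := x :* con 1 :+ con 0) refl (g Vec.[])
  ∑∑-subsets-∪ (suc m) g = begin-equality
    ∑[ G ∈ subsets (suc m) ] ∑[ H ∈ subsets (suc m) ] g (G ∪ H)
      ≈⟨ ∑-cong (subsets (suc m)) (λ G → ∑-subsets-suc m (λ H → g (G ∪ H))) ⟩
    ∑[ G ∈ subsets (suc m) ] ((∑[ H ∈ subsets m ] g (G ∪ (outside Vec.∷ H)))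
                              + (∑[ H ∈ subsets m ] g (G ∪ (inside Vec.∷ H))))
      ≈⟨ ∑-subsets-suc m _ ⟩
    (∑[ G ∈ subsets m ] (row out G + row inn G)) + (∑[ G ∈ subsets m ] (row inn G + row inn G))
      ≈⟨ +-cong (∑-+ (subsets m) (row out) (row inn)) (∑-+ (subsets m) (row inn) (row inn)) ⟩
    (∑ (subsets m) (row out) + ∑ (subsets m) (row inn))
      + (∑ (subsets m) (row inn) + ∑ (subsets m) (row inn))
      ≈⟨ +-cong (+-cong (∑∑-subsets-∪ m out) (∑∑-subsets-∪ m inn))
                (+-cong (∑∑-subsets-∪ m inn) (∑∑-subsets-∪ m inn)) ⟩
    (∑3^ out + ∑3^ inn) + (∑3^ inn + ∑3^ inn)
      ≈⟨ solve 2 (λ o i → (o :+ i) :+ (i :+ i)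
           := o :+ i :* (con 1 :+ (con 1 :+ (con 1 :+ con 0)))) refl _ _ ⟩
    ∑3^ out + ∑3^ inn * fromℕ 3
      ≈⟨ +-congˡ (∑-*ʳ (fromℕ 3) (subsets m) _) ⟨
    ∑3^ out + (∑[ H ∈ subsets m ] (inn H * fromℕ 3 ^ ∣ H ∣ * fromℕ 3))
      ≈⟨ +-congˡ (∑-cong (subsets m) (λ H →
           trans (*-assoc _ _ _) (*-congˡ (*-comm _ (fromℕ 3))))) ⟩
    ∑3^ out + (∑[ H ∈ subsets m ] (inn H * fromℕ 3 ^ suc ∣ H ∣))
      ≈⟨ ∑-subsets-suc m _ ⟨
    ∑[ H ∈ subsets (suc m) ] (g H * fromℕ 3 ^ ∣ H ∣) ∎
    where
    out inn : Subset m → Carrier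
    out H = g (outside Vec.∷ H)
    inn H = g (inside Vec.∷ H)

    row : (Subset m → Carrier) → Subset m → Carrier
    row h G = ∑[ H ∈ subsets m ] h (G ∪ H)

    ∑3^ : (Subset m → Carrier) → Carrier
    ∑3^ h = ∑[ H ∈ subsets m ] (h H * fromℕ 3 ^ ∣ H ∣)

  ∑∑-⊆ : ∀ {b} {B : Set b} {xs ys : List B} {f : B → B → Carrier} → (∀ x y → 0# ≤ f x y) →
         Unique xs → xs ⊆ ys →
         ∑[ x ∈ xs ] ∑[ y ∈ xs ] f x y ≤ ∑[ x ∈ ys ] ∑[ y ∈ ys ] f x y
  ∑∑-⊆ {xs = xs} {ys} nn u xs⊆ys =
    ≤-trans (∑-mono′ xs (λ x → ∑-⊆ (nn x) u xs⊆ys))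
            (∑-⊆ (λ x → ∑-nonNeg ys (nn x)) u xs⊆ys)

-- Weights of fixed sets and their generating polynomial c_k.

module Moments {c ℓ₁ ℓ₂} (K : OrderedField c ℓ₁ ℓ₂) where
  open OrderedField K
  open OrderedFieldProperties K
  open SubsetSums K
  open PartialOrderReasoning poset

  module MomentBounds
    {n : ℕ} (s : ℕ → ℕ) (1≤s : ∀ j → 1 ℕ.≤ j → j ℕ.≤ n → 1 ℕ.≤ s j)
    (𝒜 : List (Hyperplane s n))
    {a : ℕ} (Pₐ : Q s a → Carrier) (isProbability : IsProbability K Pₐ)
    (δ : ℕ → Carrier)
    (δ-bounds : ∀ j → a ℕ.< j → j ℕ.≤ n → (0# ≤ δ j) × (δ j ≤ 1# / fromℕ 2))
    where

    open Construction K s 𝒜 Pₐ δ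
    open IsProbability isProbability

    measure-𝟙 : ∀ {k} (P : Q s k → Carrier) (H : Hyperplane s k) →
                measure K P H ≈ ∑[ x ∈ points s k ] (𝟙 (x ∈ᴴ? H) * P x)
    measure-𝟙 {k} P H = ∑-filter (_∈ᴴ? H) (points s k) P

    masses : Subset a → List Carrier
    masses I = map (measure K Pₐ)
      (filter (λ H → Vec.≡-dec Bool._≟_ (F H) I) (hyperplanes s a))

    measure-≤-cᴵ : ∀ H → measure K Pₐ H ≤ cᴵ (F H)
    measure-≤-cᴵ H = ≤-foldr-max
      (∈-map⁺ (measure K Pₐ) (∈-filter⁺ (λ H′ → Vec.≡-dec Bool._≟_ (F H′) (F H)) (∈-hyperplanes H) ≡.refl))

    -- This is where the total mass of `Pₐ` enters. At I = ⊥ it gives c(∅) ≤ 1, the source of the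
    -- final + 1 in the refined bound.
    cᴵ-≤-1 : ∀ I → cᴵ I ≤ 1#
    cᴵ-≤-1 I = foldr-max-≤ (masses I) 0≤1 (All.map⁺ (All.universal measure-≤-1 _))
      where
      measure-≤-1 : ∀ H → measure K Pₐ H ≤ 1#
      measure-≤-1 H = begin
        measure K Pₐ H
          ≈⟨ measure-𝟙 Pₐ H ⟩
        ∑[ x ∈ points s a ] (𝟙 (x ∈ᴴ? H) * Pₐ x)
          ≤⟨ ∑-mono′ (points s a) (λ x →
               *-monoʳ-≤ (nonNeg x) (𝟙-mono (x ∈ᴴ? H) (yes tt) (λ _ → tt))) ⟩
        ∑[ x ∈ points s a ] (1# * Pₐ x)
          ≈⟨ ∑-cong (points s a) (λ x → *-identityˡ (Pₐ x)) ⟩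
        ∑[ x ∈ points s a ] Pₐ x
          ≈⟨ total ⟩
        1# ∎

    ν : ℕ → Carrier
    ν j = 1# / ((1# - δ j) * ∣S j ∣)

    -- c(I) ν(J) for the set I ∪ J with I ⊆ [a] and J ⊆ [a + 1 , a + d].
    weight : ∀ d → Subset (d ℕ.+ a) → Carrier
    weight zero    G                  = cᴵ G
    weight (suc d) (outside Vec.∷ G)  = weight d G
    weight (suc d) (inside Vec.∷ G)   = weight d G * ν (suc (d ℕ.+ a))

    weight-⊥-≤-1 : ∀ d → weight d ⊥ ≤ 1#
    weight-⊥-≤-1 zero    = cᴵ-≤-1 ⊥
    weight-⊥-≤-1 (suc d) = weight-⊥-≤-1 d

    -- Each coordinate beyond `a` is either left out, with factor 1, or chosen, with factor x times
    -- ν; summing over both choices yields one factor of `∏`.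
    ∑-weight : ∀ d x → ∑[ G ∈ subsets (d ℕ.+ a) ] (weight d G * x ^ ∣ G ∣) ≈ cₓ d x
    ∑-weight zero    x = ∑-cong (subsets a) (λ I → sym (*-identityʳ _))
    ∑-weight (suc d) x = begin-equality
      ∑[ G ∈ subsets (suc k) ] (weight (suc d) G * x ^ ∣ G ∣)
        ≈⟨ ∑-subsets-suc k _ ⟩
      lower + (∑[ G ∈ subsets k ] (weight d G * (1# * q) * (x * x ^ ∣ G ∣)))
        ≈⟨ +-congˡ (∑-cong (subsets k) (λ G →
             solve 4 (λ w q x y → w :* (con 1 :* q) :* (x :* y) := w :* y :* (x :* q)) refl _ _ _ _)) ⟩
      lower + (∑[ G ∈ subsets k ] (weight d G * x ^ ∣ G ∣ * (x * q)))
        ≈⟨ +-congˡ (∑-*ʳ (x * q) (subsets k) _) ⟩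
      lower + lower * (x * q)
        ≈⟨ solve 2 (λ l r → l :+ l :* r := l :* (con 1 :+ r)) refl _ _ ⟩
      lower * (1# + x * q)
        ≈⟨ *-congʳ (∑-weight d x) ⟩
      cₓ d x * (1# + x * q)
        ≈⟨ ∑-*ʳ (1# + x * q) (subsets a) _ ⟨
      ∑[ I ∈ subsets a ] (cᴵ I * x ^ ∣ I ∣ * ∏ d x * (1# + x * q))
        ≈⟨ ∑-cong (subsets a) (λ I → *-assoc _ _ _) ⟩
      cₓ (suc d) x ∎
      where
      k = d ℕ.+ a
      q = ((1# - δ (suc k)) * ∣S suc k ∣) ⁻¹
      lower = ∑[ G ∈ subsets k ] (weight d G * x ^ ∣ G ∣)

    ∑-weight-1 : ∀ d → ∑ (subsets (d ℕ.+ a)) (weight d) ≈ cₓ d 1#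
    ∑-weight-1 d = trans
      (∑-cong (subsets (d ℕ.+ a)) (λ G → sym (trans (*-congˡ (1^m≈1 ∣ G ∣)) (*-identityʳ _))))
      (∑-weight d 1#)

    ∑∑-weight-∪ : ∀ d → ∑[ G ∈ subsets (d ℕ.+ a) ] ∑[ H ∈ subsets (d ℕ.+ a) ] weight d (G ∪ H) ≈ cₓ d (fromℕ 3)
    ∑∑-weight-∪ d = trans (∑∑-subsets-∪ (d ℕ.+ a) (weight d)) (∑-weight d (fromℕ 3))

    -- In the square of all pairs the row and the column of ⊥ each sum to c₁, because ⊥ ∪ H = H, and
    -- they share the corner. What remains is c₃ - 2c₁ + w(⊥), where w(⊥) is at most 1.
    ∑∑-nonempties-weight-∪ : ∀ d →
      ∑[ G ∈ nonempties (d ℕ.+ a) ] ∑[ H ∈ nonempties (d ℕ.+ a) ] weight d (G ∪ H)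
        ≤ cₓ d (fromℕ 3) - fromℕ 2 * cₓ d 1# + 1#
    ∑∑-nonempties-weight-∪ d = begin
      N
        ≤⟨ ≤-minus (begin
          fromℕ 2 * c₁ + N
            ≈⟨ solve 2 (λ c n → (con 1 :+ (con 1 :+ con 0)) :* c :+ n := (c :+ (c :+ n))) refl _ _ ⟩
          c₁ + (c₁ + N)
            -- One copy of c₁ is the full row of ⊥. The other is opened as `w ⊥ + W`, since the
            -- column below that row lacks the corner.
            ≈⟨ +-congˡ (+-congʳ (trans (sym (∑-weight-1 d)) (∑-subsets-⊥ k w))) ⟩
          c₁ + ((w ⊥ + W) + N)
            ≈⟨ solve 4 (λ c v W N → c :+ ((v :+ W) :+ N) := (c :+ (W :+ N)) :+ v) refl _ _ _ _ ⟩
          (c₁ + (W + N)) + w ⊥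
            ≈⟨ +-congʳ c₃≈ ⟨
          c₃ + w ⊥
            ≤⟨ +-monoʳ-≤ c₃ (weight-⊥-≤-1 d) ⟩
          c₃ + 1# ∎) ⟩
      c₃ + 1# - fromℕ 2 * c₁
        ≈⟨ solve 2 (λ x y → (x :+ con 1) :+ y := (x :+ y) :+ con 1) refl c₃ _ ⟩
      c₃ - fromℕ 2 * c₁ + 1# ∎
      where
      k  = d ℕ.+ a
      w  = weight d
      c₁ = cₓ d 1#
      c₃ = cₓ d (fromℕ 3)
      W  = ∑ (nonempties k) w
      N  = ∑[ G ∈ nonempties k ] ∑[ H ∈ nonempties k ] w (G ∪ H)

      c₃≈ : c₃ ≈ c₁ + (W + N)
      c₃≈ = begin-equality
        c₃
          ≈⟨ ∑∑-weight-∪ d ⟨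
        ∑[ G ∈ subsets k ] ∑[ H ∈ subsets k ] w (G ∪ H)
          ≈⟨ ∑-subsets-⊥ k _ ⟩
        (∑[ H ∈ subsets k ] w (⊥ ∪ H)) + (∑[ G ∈ nonempties k ] ∑[ H ∈ subsets k ] w (G ∪ H))
          ≈⟨ +-cong (∑-cong (subsets k) (λ H → reflexive (≡.cong w (∪-identityˡ H))))
                    (∑-cong (nonempties k) (λ G → trans (∑-subsets-⊥ k (λ H → w (G ∪ H)))
                      (+-congʳ (reflexive (≡.cong w (∪-identityʳ G)))))) ⟩
        ∑ (subsets k) w + (∑[ G ∈ nonempties k ] (w G + (∑[ H ∈ nonempties k ] w (G ∪ H))))
          ≈⟨ +-cong (∑-weight-1 d) (∑-+ (nonempties k) w _) ⟩
        c₁ + (W + N) ∎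

    -- Measures of hyperplanes under ℙ.

    ∣S∣-positive : ∀ {k} → suc k ℕ.≤ n → Positive ∣S suc k ∣
    ∣S∣-positive {k} k<n = fromℕ-positive (s (suc k)) (1≤s (suc k) (ℕ.s≤s ℕ.z≤n) k<n)

    1-δ-positive : ∀ d → suc (d ℕ.+ a) ℕ.≤ n → Positive (1# - δ (suc (d ℕ.+ a)))
    1-δ-positive d k<n = δ≤½⇒1-δ-positive (proj₂ (δ-bounds _ (ℕ.s≤s (ℕ.m≤n+m a d)) k<n))

    -- The `multiplier` of this instance unfolds to `factor (d ℕ.+ a) x`, so facts about one fibre
    -- apply to ℙ as they stand.
    module Fibre (d : ℕ) (k<n : suc (d ℕ.+ a) ℕ.≤ n) (x : Q s (d ℕ.+ a)) =
      Reweighting (λ y → B? 𝒜 (d ℕ.+ a) (x ▸ y)) (allFin (s (suc (d ℕ.+ a))))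
        (length-tabulate id) (1≤s (suc (d ℕ.+ a)) (ℕ.s≤s ℕ.z≤n) k<n)
        (proj₁ (δ-bounds _ (ℕ.s≤s (ℕ.m≤n+m a d)) k<n)) (1-δ-positive d k<n)

    ν-nonNeg : ∀ d → suc (d ℕ.+ a) ℕ.≤ n → 0# ≤ ν (suc (d ℕ.+ a))
    ν-nonNeg d k<n = *-nonNeg 0≤1 (⁻¹-nonNeg (*-positive (1-δ-positive d k<n) (∣S∣-positive k<n)))

    weight-nonNeg : ∀ d → d ℕ.+ a ℕ.≤ n → ∀ G → 0# ≤ weight d G
    weight-nonNeg zero    _   G                 = 0≤foldr-max (masses G)
    weight-nonNeg (suc d) k<n (outside Vec.∷ G) = weight-nonNeg d (ℕ.<⇒≤ k<n) G
    weight-nonNeg (suc d) k<n (inside Vec.∷ G)  = *-nonNeg (weight-nonNeg d (ℕ.<⇒≤ k<n) G) (ν-nonNeg d k<n)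

    ℙ-nonNeg : ∀ d → d ℕ.+ a ℕ.≤ n → ∀ x → 0# ≤ ℙ d x
    ℙ-nonNeg zero    _   x       = nonNeg x
    ℙ-nonNeg (suc d) k<n (x ▸ y) = *-nonNeg (Fibre.multiplier-nonNeg d k<n x (∈-allFin y))
      (*-nonNeg (ℙ-nonNeg d (ℕ.<⇒≤ k<n) x) (⁻¹-nonNeg (∣S∣-positive k<n)))

    -- The multipliers over a fibre sum to at most its size, which cancels the division by that
    -- size. Hence a coordinate left free costs no factor.
    ℙ-marginal : ∀ d → suc (d ℕ.+ a) ℕ.≤ n → ∀ x →
                 ∑[ y ∈ allFin (s (suc (d ℕ.+ a))) ] ℙ (suc d) (x ▸ y) ≤ ℙ d x
    ℙ-marginal d k<n x = begin
      ∑[ y ∈ allFin (s (suc k)) ] (factor k x y * (ℙ d x / S))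
        ≈⟨ ∑-*ʳ _ (allFin (s (suc k))) (factor k x) ⟩
      ∑ (allFin (s (suc k))) (factor k x) * (ℙ d x / S)
        ≤⟨ *-monoʳ-≤ (*-nonNeg (ℙ-nonNeg d (ℕ.<⇒≤ k<n) x) (⁻¹-nonNeg (∣S∣-positive k<n)))
                     (Fibre.∑-multiplier-≤ d k<n x) ⟩
      S * (ℙ d x / S)
        ≈⟨ *-comm _ _ ⟩
      ℙ d x / S * S
        ≈⟨ /-* _ (∣S∣-positive k<n) ⟩
      ℙ d x ∎
      where
      k = d ℕ.+ a
      S = ∣S suc k ∣

    -- No multiplier exceeds 1/(1 - δ); this is the price ν of a fixed coordinate.
    ℙ-≤-ν : ∀ d → suc (d ℕ.+ a) ℕ.≤ n → ∀ x y → ℙ (suc d) (x ▸ y) ≤ ℙ d x * ν (suc (d ℕ.+ a))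
    ℙ-≤-ν d k<n x y = begin
      factor k x y * (ℙ d x * S ⁻¹)
        ≤⟨ *-monoʳ-≤ (*-nonNeg (ℙ-nonNeg d (ℕ.<⇒≤ k<n) x) (⁻¹-nonNeg (∣S∣-positive k<n)))
                     (Fibre.multiplier-≤ d k<n x (∈-allFin y)) ⟩
      1# * (1# - δ (suc k)) ⁻¹ * (ℙ d x * S ⁻¹)
        ≈⟨ solve 3 (λ e p i → (con 1 :* e) :* (p :* i) := p :* (con 1 :* (e :* i))) refl _ _ _ ⟩
      ℙ d x * (1# * ((1# - δ (suc k)) ⁻¹ * S ⁻¹))
        ≈⟨ *-congˡ (*-congˡ (⁻¹-* (1-δ-positive d k<n) (∣S∣-positive k<n))) ⟨
      ℙ d x * ν (suc k) ∎
      where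
      k = d ℕ.+ a
      S = ∣S suc k ∣

    -- Induction on `d`, summing over the last coordinate first: if free, it is removed by
    -- `ℙ-marginal`; if fixed, one point of each fibre remains and `ℙ-≤-ν` applies. The base case is
    -- the maximum that defines c(I).
    measure-≤-weight : ∀ d → d ℕ.+ a ℕ.≤ n → ∀ H → measure K (ℙ d) H ≤ weight d (F H)
    measure-≤-weight zero    _   H       = measure-≤-cᴵ H
    measure-≤-weight (suc d) k<n (H ▸ m) = begin
      measure K (ℙ (suc d)) (H ▸ m)
        ≈⟨ measure-𝟙 (ℙ (suc d)) (H ▸ m) ⟩
      ∑[ z ∈ points s (suc k) ] (𝟙 (z ∈ᴴ? (H ▸ m)) * ℙ (suc d) z)
        ≈⟨ ∑-cartesianProductWith _▸_ (points s k) ys _ ⟩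
      ∑[ x ∈ points s k ] ∑[ y ∈ ys ] (𝟙 ((x ▸ y) ∈ᴴ? (H ▸ m)) * ℙ (suc d) (x ▸ y))
        ≈⟨ ∑-cong (points s k) (λ x → trans
             (∑-cong ys (λ y → trans (*-congʳ (𝟙-× (x ∈ᴴ? H) (_∈ᶜ?_ {s} {suc k} y m))) (*-assoc _ _ _)))
             (∑-*ˡ (𝟙 (x ∈ᴴ? H)) ys (section m x))) ⟩
      ∑[ x ∈ points s k ] (𝟙 (x ∈ᴴ? H) * ∑ ys (section m x))
        ≤⟨ bound m ⟩
      weight (suc d) (F (H ▸ m)) ∎
      where
      k  = d ℕ.+ a
      ys = allFin (s (suc k))

      section : Maybe (Fin (s (suc k))) → Q s k → Fin (s (suc k)) → Carrier
      section m x y = 𝟙 (_∈ᶜ?_ {s} {suc k} y m) * ℙ (suc d) (x ▸ y)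

      bound : ∀ m → ∑[ x ∈ points s k ] (𝟙 (x ∈ᴴ? H) * ∑ ys (section m x)) ≤ weight (suc d) (F (H ▸ m))
      bound nothing = begin
        ∑[ x ∈ points s k ] (𝟙 (x ∈ᴴ? H) * ∑ ys (section nothing x))
          ≤⟨ ∑-mono′ (points s k) (λ x → *-monoˡ-≤ (𝟙-nonNeg (x ∈ᴴ? H))
               (≤-trans (≤-reflexive (∑-cong ys (λ y → *-identityˡ _))) (ℙ-marginal d k<n x))) ⟩
        ∑[ x ∈ points s k ] (𝟙 (x ∈ᴴ? H) * ℙ d x)
          ≈⟨ measure-𝟙 (ℙ d) H ⟨
        measure K (ℙ d) H
          ≤⟨ measure-≤-weight d (ℕ.<⇒≤ k<n) H ⟩
        weight d (F H) ∎
      bound (just z) = begin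
        ∑[ x ∈ points s k ] (𝟙 (x ∈ᴴ? H) * ∑ ys (section (just z) x))
          ≤⟨ ∑-mono′ (points s k) (λ x → *-monoˡ-≤ (𝟙-nonNeg (x ∈ᴴ? H))
               (≤-trans (∑-𝟙-≟ z (λ y → ℙ (suc d) (x ▸ y)) (λ y → ℙ-nonNeg (suc d) k<n (x ▸ y)))
                        (ℙ-≤-ν d k<n x z))) ⟩
        ∑[ x ∈ points s k ] (𝟙 (x ∈ᴴ? H) * (ℙ d x * ν (suc k)))
          ≈⟨ ∑-cong (points s k) (λ x → sym (*-assoc _ _ _)) ⟩
        ∑[ x ∈ points s k ] (𝟙 (x ∈ᴴ? H) * ℙ d x * ν (suc k))
          ≈⟨ ∑-*ʳ (ν (suc k)) (points s k) _ ⟩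
        (∑[ x ∈ points s k ] (𝟙 (x ∈ᴴ? H) * ℙ d x)) * ν (suc k)
          ≈⟨ *-congʳ (measure-𝟙 (ℙ d) H) ⟨
        measure K (ℙ d) H * ν (suc k)
          ≤⟨ *-monoʳ-≤ (ν-nonNeg d k<n) (measure-≤-weight d (ℕ.<⇒≤ k<n) H) ⟩
        weight d (F H) * ν (suc k) ∎

    -- The moments of α as sums of weights.

    incidences : ∀ {k} → List (Hyperplane s k) → Q s k → Carrier
    incidences Hs x = ∑[ H ∈ Hs ] 𝟙 (x ∈ᴴ? H)

    incidences-nonNeg : ∀ {k} (Hs : List (Hyperplane s k)) x → 0# ≤ incidences Hs x
    incidences-nonNeg Hs x = ∑-nonNeg Hs (λ H → 𝟙-nonNeg (x ∈ᴴ? H))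

    -- Linearity of expectation, for an arbitrary list: it serves the traces for the first moment
    -- and their meets for the second.
    ∑-ℙ-incidences-≤ : ∀ d → d ℕ.+ a ℕ.≤ n → (Hs : List (Hyperplane s (d ℕ.+ a))) →
      ∑[ x ∈ points s (d ℕ.+ a) ] (ℙ d x * incidences Hs x) ≤ ∑[ H ∈ Hs ] weight d (F H)
    ∑-ℙ-incidences-≤ d k≤n Hs = begin
      ∑[ x ∈ X ] (ℙ d x * incidences Hs x)
        ≈⟨ ∑-cong X (λ x → trans (*-comm _ _) (sym (∑-*ʳ (ℙ d x) Hs _))) ⟩
      ∑[ x ∈ X ] ∑[ H ∈ Hs ] (𝟙 (x ∈ᴴ? H) * ℙ d x)
        ≈⟨ ∑-swap X Hs _ ⟩
      ∑[ H ∈ Hs ] ∑[ x ∈ X ] (𝟙 (x ∈ᴴ? H) * ℙ d x)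
        ≤⟨ ∑-mono′ Hs (λ H → ≤-trans (≤-reflexive (sym (measure-𝟙 (ℙ d) H)))
                                     (measure-≤-weight d k≤n H)) ⟩
      ∑[ H ∈ Hs ] weight d (F H) ∎
      where X = points s (d ℕ.+ a)

    -- Only one point of the fibre over `x` has the prescribed last coordinate. This is the origin
    -- of the factor 1/|S_k|.
    fixesLast-fibre : ∀ {k} (x : Q s k) {A : Hyperplane s (suc k)} → FixesLast A →
      ∑[ y ∈ allFin (s (suc k)) ] 𝟙 ((x ▸ y) ∈ᴴ? A) ≤ 𝟙 (x ∈ᴴ? init A)
    fixesLast-fibre {k} x {A ▸ just z} _ = begin
      ∑[ y ∈ allFin (s (suc k)) ] 𝟙 ((x ▸ y) ∈ᴴ? (A ▸ just z))
        ≈⟨ ∑-cong (allFin (s (suc k))) (λ y →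
             trans (𝟙-× (x ∈ᴴ? A) (y Fin.≟ z)) (*-comm _ _)) ⟩
      ∑[ y ∈ allFin (s (suc k)) ] (𝟙 (y Fin.≟ z) * 𝟙 (x ∈ᴴ? A))
        ≤⟨ ∑-𝟙-≟ z (λ _ → 𝟙 (x ∈ᴴ? A)) (λ _ → 𝟙-nonNeg (x ∈ᴴ? A)) ⟩
      𝟙 (x ∈ᴴ? A) ∎

    -- The union bound over `𝒩`, after which each hyperplane accounts for at most one point of the
    -- fibre.
    α-≤ : ∀ {k} → suc k ℕ.≤ n → ∀ x → α k x ≤ incidences (traces 𝒜 k) x / ∣S suc k ∣
    α-≤ {k} k<n x = *-monoʳ-≤ (⁻¹-nonNeg (∣S∣-positive k<n)) (begin
      fromℕ (length (filter (λ y → B? 𝒜 k (x ▸ y)) ys))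
        ≈⟨ length-filter-𝟙 (λ y → B? 𝒜 k (x ▸ y)) ys ⟩
      ∑[ y ∈ ys ] 𝟙 (B? 𝒜 k (x ▸ y))
        ≤⟨ ∑-mono′ ys (λ y → 𝟙-any? ((x ▸ y) ∈ᴴ?_) (𝒩 𝒜 k)) ⟩
      ∑[ y ∈ ys ] ∑[ A ∈ 𝒩 𝒜 k ] 𝟙 ((x ▸ y) ∈ᴴ? A)
        ≈⟨ ∑-swap ys (𝒩 𝒜 k) _ ⟩
      ∑[ A ∈ 𝒩 𝒜 k ] ∑[ y ∈ ys ] 𝟙 ((x ▸ y) ∈ᴴ? A)
        ≤⟨ ∑-mono (𝒩 𝒜 k) (All.map (fixesLast-fibre x) (𝒩-fixesLast 𝒜 k)) ⟩
      ∑[ A ∈ 𝒩 𝒜 k ] 𝟙 (x ∈ᴴ? init A)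
        ≈⟨ ∑-map init (𝒩 𝒜 k) _ ⟨
      incidences (traces 𝒜 k) x ∎)
      where ys = allFin (s (suc k))

    α-nonNeg : ∀ {k} → suc k ℕ.≤ n → ∀ x → 0# ≤ α k x
    α-nonNeg k<n x = *-nonNeg
      (fromℕ-nonNeg (length (filter (λ y → B? 𝒜 _ (x ▸ y)) (allFin _))))
      (⁻¹-nonNeg (∣S∣-positive k<n))

    meets : ∀ {k} → List (Hyperplane s k) → List (Hyperplane s k)
    meets Hs = cartesianProductWith meet Hs Hs

    -- The square counts ordered pairs through `x`, the diagonal included, and a point of both
    -- members lies in their meet.
    incidences²-≤ : ∀ {k} (Hs : List (Hyperplane s k)) x →
                    incidences Hs x * incidences Hs x ≤ incidences (meets Hs) x
    incidences²-≤ Hs x = begin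
      incidences Hs x * incidences Hs x
        ≈⟨ ∑-*ʳ _ Hs _ ⟨
      ∑[ H ∈ Hs ] (𝟙 (x ∈ᴴ? H) * incidences Hs x)
        ≈⟨ ∑-cong Hs (λ H → sym (∑-*ˡ _ Hs _)) ⟩
      ∑[ H ∈ Hs ] ∑[ H′ ∈ Hs ] (𝟙 (x ∈ᴴ? H) * 𝟙 (x ∈ᴴ? H′))
        ≤⟨ ∑-mono′ Hs (λ H → ∑-mono′ Hs (λ H′ →
             ≤-trans (≤-reflexive (sym (𝟙-× (x ∈ᴴ? H) (x ∈ᴴ? H′))))
                     (𝟙-mono ((x ∈ᴴ? H) ×-dec (x ∈ᴴ? H′)) (x ∈ᴴ? meet H H′)
                             (λ (x∈H , x∈H′) → ∈ᴴ-meet x H H′ x∈H x∈H′)))) ⟩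
      ∑[ H ∈ Hs ] ∑[ H′ ∈ Hs ] 𝟙 (x ∈ᴴ? meet H H′)
        ≈⟨ ∑-cartesianProductWith meet Hs Hs _ ⟨
      incidences (meets Hs) x ∎

    M₁-≤ : ∀ d → suc (d ℕ.+ a) ℕ.≤ n →
           M 1 d ≤ ∑ (supports 𝒜 (d ℕ.+ a)) (weight d) / ∣S suc (d ℕ.+ a) ∣
    M₁-≤ d k<n = begin
      ∑[ x ∈ X ] (ℙ d x * (α k x * 1#))
        ≤⟨ ∑-mono′ X (λ x → *-monoˡ-≤ (ℙ-nonNeg d (ℕ.<⇒≤ k<n) x)
             (≤-trans (≤-reflexive (*-identityʳ _)) (α-≤ k<n x))) ⟩
      ∑[ x ∈ X ] (ℙ d x * (incidences Hs x * S ⁻¹))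
        ≈⟨ ∑-cong X (λ x → sym (*-assoc _ _ _)) ⟩
      ∑[ x ∈ X ] (ℙ d x * incidences Hs x * S ⁻¹)
        ≈⟨ ∑-*ʳ (S ⁻¹) X _ ⟩
      (∑[ x ∈ X ] (ℙ d x * incidences Hs x)) * S ⁻¹
        ≤⟨ *-monoʳ-≤ (⁻¹-nonNeg (∣S∣-positive k<n)) (∑-ℙ-incidences-≤ d (ℕ.<⇒≤ k<n) Hs) ⟩
      (∑[ H ∈ Hs ] weight d (F H)) * S ⁻¹
        ≈⟨ *-congʳ (∑-map F Hs (weight d)) ⟨
      ∑ (supports 𝒜 k) (weight d) * S ⁻¹ ∎
      where
      k  = d ℕ.+ a
      X  = points s k
      S  = ∣S suc k ∣
      Hs = traces 𝒜 k

    -- Replacing pairs of traces by their meets turns the second moment into a first moment of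
    -- another list of hyperplanes.
    M₂-≤ : ∀ d → suc (d ℕ.+ a) ℕ.≤ n → let Gs = supports 𝒜 (d ℕ.+ a) in
           M 2 d ≤ (∑[ G ∈ Gs ] ∑[ H ∈ Gs ] weight d (G ∪ H)) / (∣S suc (d ℕ.+ a) ∣ ^ 2)
    M₂-≤ d k<n = begin
      ∑[ x ∈ X ] (ℙ d x * (α k x * (α k x * 1#)))
        ≤⟨ ∑-mono′ X (λ x → *-monoˡ-≤ (ℙ-nonNeg d (ℕ.<⇒≤ k<n) x) (α²-≤ x)) ⟩
      ∑[ x ∈ X ] (ℙ d x * (incidences (meets Hs) x * (S ^ 2) ⁻¹))
        ≈⟨ ∑-cong X (λ x → sym (*-assoc _ _ _)) ⟩
      ∑[ x ∈ X ] (ℙ d x * incidences (meets Hs) x * (S ^ 2) ⁻¹)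
        ≈⟨ ∑-*ʳ ((S ^ 2) ⁻¹) X _ ⟩
      (∑[ x ∈ X ] (ℙ d x * incidences (meets Hs) x)) * (S ^ 2) ⁻¹
        ≤⟨ *-monoʳ-≤ 0≤[S^2]⁻¹ (∑-ℙ-incidences-≤ d (ℕ.<⇒≤ k<n) (meets Hs)) ⟩
      (∑[ H ∈ meets Hs ] weight d (F H)) * (S ^ 2) ⁻¹
        ≈⟨ *-congʳ ∑-meets ⟩
      (∑[ G ∈ map F Hs ] ∑[ H ∈ map F Hs ] weight d (G ∪ H)) * (S ^ 2) ⁻¹ ∎
      where
      k  = d ℕ.+ a
      X  = points s k
      S  = ∣S suc k ∣
      Hs = traces 𝒜 k
      S>0 = ∣S∣-positive k<n

      0≤S⁻¹ : 0# ≤ S ⁻¹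
      0≤S⁻¹ = ⁻¹-nonNeg S>0

      0≤[S^2]⁻¹ : 0# ≤ (S ^ 2) ⁻¹
      0≤[S^2]⁻¹ = ≤-trans (*-nonNeg 0≤S⁻¹ 0≤S⁻¹) (≤-reflexive (sym ([x^2]⁻¹ S>0)))

      α²-≤ : ∀ x → α k x * (α k x * 1#) ≤ incidences (meets Hs) x * (S ^ 2) ⁻¹
      α²-≤ x = begin
        α k x * (α k x * 1#)
          ≈⟨ *-congˡ (*-identityʳ _) ⟩
        α k x * α k x
          ≤⟨ *-mono-≤ (*-nonNeg (incidences-nonNeg Hs x) 0≤S⁻¹) (α-nonNeg k<n x) (α-≤ k<n x) (α-≤ k<n x) ⟩
        (incidences Hs x * S ⁻¹) * (incidences Hs x * S ⁻¹)
          ≈⟨ solve 2 (λ t i → (t :* i) :* (t :* i) := (t :* t) :* (i :* i)) refl _ _ ⟩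
        (incidences Hs x * incidences Hs x) * (S ⁻¹ * S ⁻¹)
          ≤⟨ *-monoʳ-≤ (*-nonNeg 0≤S⁻¹ 0≤S⁻¹) (incidences²-≤ Hs x) ⟩
        incidences (meets Hs) x * (S ⁻¹ * S ⁻¹)
          ≈⟨ *-congˡ ([x^2]⁻¹ S>0) ⟨
        incidences (meets Hs) x * (S ^ 2) ⁻¹ ∎

      ∑-meets : ∑[ H ∈ meets Hs ] weight d (F H) ≈ ∑[ G ∈ map F Hs ] ∑[ H ∈ map F Hs ] weight d (G ∪ H)
      ∑-meets = begin-equality
        ∑[ H ∈ meets Hs ] weight d (F H)
          ≈⟨ ∑-cartesianProductWith meet Hs Hs _ ⟩
        ∑[ G ∈ Hs ] ∑[ H ∈ Hs ] weight d (F (meet G H))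
          ≈⟨ ∑-cong Hs (λ G → ∑-cong Hs (λ H → reflexive (≡.cong (weight d) (F-meet G H)))) ⟩
        ∑[ G ∈ Hs ] ∑[ H ∈ Hs ] weight d (F G ∪ F H)
          ≈⟨ ∑-cong Hs (λ G → sym (∑-map F Hs _)) ⟩
        ∑[ G ∈ Hs ] ∑[ H ∈ map F Hs ] weight d (F G ∪ H)
          ≈⟨ ∑-map F Hs _ ⟨
        ∑[ G ∈ map F Hs ] ∑[ H ∈ map F Hs ] weight d (G ∪ H) ∎

theorem3p2 :
    ∀ {c ℓ₁ ℓ₂} (K : OrderedField c ℓ₁ ℓ₂) → let open OrderedField K in
    (n : ℕ) (s : ℕ → ℕ) → (∀ j → 1 ℕ.≤ j → j ℕ.≤ n → 2 ℕ.≤ s j) →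
    (𝒜 : List (Hyperplane s n)) →
    All (λ A → Nonempty (F A)) 𝒜 →
    AllPairs (λ A A′ → ¬ Parallel A A′) 𝒜 →
    (a : ℕ) → a ℕ.≤ n →
    (Pₐ : Q s a → Carrier) → IsProbability K Pₐ →
    (δ : ℕ → Carrier) →
    (∀ j → a ℕ.< j → j ℕ.≤ n → (0# ≤ δ j) × (δ j ≤ 1# / fromℕ 2)) →
    let open Construction K s 𝒜 Pₐ δ in
    (d : ℕ) → let k = suc (d ℕ.+ a) in k ℕ.≤ n →
    (M 1 d ≤ cₓ d 1# / ∣S k ∣) ×
    (M 2 d ≤ cₓ d (fromℕ 3) / (∣S k ∣ ^ 2)) ×
    ((∀ j → 1 ℕ.≤ j → j ℕ.≤ n → 3 ℕ.≤ s j) →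
     All (λ A → ∣ F A ∣ ≢ 1) (𝒩 𝒜 (d ℕ.+ a)) →
     M 2 d ≤ (1# / (∣S k ∣ ^ 2)) * (cₓ d (fromℕ 3) - fromℕ 2 * cₓ d 1# + 1#))
theorem3p2 K n s 2≤s 𝒜 _ 𝒜∦ a _ Pₐ isProbability δ δ-bounds d k<n =
  first , second , third
  where
  open OrderedField K
  open OrderedFieldProperties K
  open SubsetSums K
  open PartialOrderReasoning poset
  open Construction K s 𝒜 Pₐ δ
  open Moments.MomentBounds K s (λ j 1≤j j≤n → ℕ.<⇒≤ (2≤s j 1≤j j≤n)) 𝒜 Pₐ isProbability δ δ-bounds

  -- From here on `k` is one less than in the statement: the traces live in Q_k, and `S` is the size
  -- of the next factor.
  k = d ℕ.+ a
  S = ∣S suc k ∣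
  Gs = supports 𝒜 k

  unique : Unique Gs
  unique = supports-unique 𝒜 k 𝒜∦

  0≤weight : ∀ G → 0# ≤ weight d G
  0≤weight = weight-nonNeg d (ℕ.<⇒≤ k<n)

  0≤S⁻¹ : 0# ≤ S ⁻¹
  0≤S⁻¹ = ⁻¹-nonNeg (∣S∣-positive k<n)

  0≤[S^2]⁻¹ : 0# ≤ (S ^ 2) ⁻¹
  0≤[S^2]⁻¹ = ≤-trans (*-nonNeg 0≤S⁻¹ 0≤S⁻¹) (≤-reflexive (sym ([x^2]⁻¹ (∣S∣-positive k<n))))

  first : M 1 d ≤ cₓ d 1# / S
  first = begin
    M 1 d                          ≤⟨ M₁-≤ d k<n ⟩
    ∑ Gs (weight d) / S
      -- Non-parallelism enters through `unique`: no subset is charged twice.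
      ≤⟨ *-monoʳ-≤ 0≤S⁻¹ (∑-⊆ 0≤weight unique (λ {G} _ → ∈-subsets G)) ⟩
    ∑ (subsets k) (weight d) / S   ≈⟨ *-congʳ (∑-weight-1 d) ⟩
    cₓ d 1# / S                    ∎

  second : M 2 d ≤ cₓ d (fromℕ 3) / (S ^ 2)
  second = begin
    M 2 d
      ≤⟨ M₂-≤ d k<n ⟩
    (∑[ G ∈ Gs ] ∑[ H ∈ Gs ] weight d (G ∪ H)) / (S ^ 2)
      -- The lists are enlarged while the sum still runs over pairs. Different pairs may have the
      -- same union, and grouping by union comes only afterwards.
      ≤⟨ *-monoʳ-≤ 0≤[S^2]⁻¹
           (∑∑-⊆ (λ G H → 0≤weight (G ∪ H)) unique (λ {G} _ → ∈-subsets G)) ⟩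
    (∑[ G ∈ subsets k ] ∑[ H ∈ subsets k ] weight d (G ∪ H)) / (S ^ 2)
      ≈⟨ *-congʳ (∑∑-weight-∪ d) ⟩
    cₓ d (fromℕ 3) / (S ^ 2) ∎

  third : (∀ j → 1 ℕ.≤ j → j ℕ.≤ n → 3 ℕ.≤ s j) →
          All (λ A → ∣ F A ∣ ≢ 1) (𝒩 𝒜 k) →
          M 2 d ≤ (1# / (S ^ 2)) * (cₓ d (fromℕ 3) - fromℕ 2 * cₓ d 1# + 1#)
  third _ F≢1 = begin
    M 2 d
      ≤⟨ M₂-≤ d k<n ⟩
    (∑[ G ∈ Gs ] ∑[ H ∈ Gs ] weight d (G ∪ H)) / (S ^ 2)
      ≤⟨ *-monoʳ-≤ 0≤[S^2]⁻¹ (∑∑-⊆ (λ G H → 0≤weight (G ∪ H)) unique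
           (λ {G} G∈ → ∈-nonempties G (All.lookup (supports-nonempty 𝒜 k F≢1) G∈))) ⟩
    (∑[ G ∈ nonempties k ] ∑[ H ∈ nonempties k ] weight d (G ∪ H)) / (S ^ 2)
      ≤⟨ *-monoʳ-≤ 0≤[S^2]⁻¹ (∑∑-nonempties-weight-∪ d) ⟩
    (cₓ d (fromℕ 3) - fromℕ 2 * cₓ d 1# + 1#) / (S ^ 2)
      ≈⟨ trans (*-comm _ _) (*-congʳ (sym (*-identityˡ _))) ⟩
    (1# / (S ^ 2)) * (cₓ d (fromℕ 3) - fromℕ 2 * cₓ d 1# + 1#) ∎
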